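{- Let $r_k(n)$ be as in the context and let $E_n=\frac{\sum_k k\, r_k(n)}{\sum_k r_k(n)}$ be the expected number of pieces in a uniformly random division of the $2\times n$ strip. Then, as $n\to\infty$, $$E_n \sim \left(\frac{3}{2}-\sqrt{\frac{2}{5}}\right) n \approx 0.867544\, n.$$
   Context: For integers $n\ge 1$ and $k$, $r_k(n)$ denotes the number of ways to divide a $2\times n$ rectangular strip of $2n$ unit squares (2 rows, $n$ columns) into exactly $k$ pieces by cutting only along edges of the unit squares, each piece being an edge-connected union of unit squares (equivalently, partitions of the vertex set of the ladder graph $P_2\times P_n$ into $k$ blocks each inducing a connected subgraph). All divisions of a given strip are considered equally likely. -}

module Defs where

open import Data.Bool using (Bool; true; false; _∧_; _∨_; not; T)
open import Data.Nat using (ℕ; zero; suc; _+_; _*_; _/_; _≡ᵇ_; _<ᵇ_; _!)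
open import Data.Nat.Properties using (_!≢0)
open import Data.List using (List; []; _∷_; map; concatMap; filter; length; upTo)
open import Data.Nat.ListAction using (sum)
open import Data.Sum using (_⊎_)
open import Data.Product using (_×_; _,_)
open import Data.Integer using (+_)
open import Data.Rational as ℚ using (ℚ; 0ℚ; _<_) renaming (_/_ to _ℚ/_)
open import Relation.Nullary.Decidable using (yes; no)
open import Data.Bool using (_≟_)

-- Vertices of the ladder graph P₂ × Pₙ: pairs (row , column), row < 2, column < n.
Vertex : Set
Vertex = ℕ × ℕ

vertices : ℕ → List Vertex
vertices n = concatMap (λ r → map (λ c → (r , c)) (upTo n)) (upTo 2)

adj : Vertex → Vertex → Bool
adj (r₁ , c₁) (r₂ , c₂) =
  ((c₁ ≡ᵇ c₂) ∧ not (r₁ ≡ᵇ r₂)) ∨ ((r₁ ≡ᵇ r₂) ∧ ((suc c₁ ≡ᵇ c₂) ∨ (suc c₂ ≡ᵇ c₁)))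

eqV : Vertex → Vertex → Bool
eqV (r₁ , c₁) (r₂ , c₂) = (r₁ ≡ᵇ r₂) ∧ (c₁ ≡ᵇ c₂)

anyB : {A : Set} → (A → Bool) → List A → Bool
anyB p [] = false
anyB p (x ∷ xs) = p x ∨ anyB p xs

allB : {A : Set} → (A → Bool) → List A → Bool
allB p [] = true
allB p (x ∷ xs) = p x ∧ allB p xs

memV : Vertex → List Vertex → Bool
memV v R = anyB (eqV v) R

-- A labeling of the 2n cells by labels < k, stored as a list; cell (r , c) has index r * n + c.
allLabelings : ℕ → ℕ → List (List ℕ)
allLabelings k zero = [] ∷ []
allLabelings k (suc m) = concatMap (λ l → map (λ j → j ∷ l) (upTo k)) (allLabelings k m)

nth : List ℕ → ℕ → ℕ
nth [] _ = 0
nth (x ∷ xs) zero = x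
nth (x ∷ xs) (suc i) = nth xs i

label : ℕ → List ℕ → Vertex → ℕ
label n l (r , c) = nth l (r * n + c)

block : ℕ → List ℕ → ℕ → List Vertex
block n l j = filter (λ v → (label n l v ≡ᵇ j) ≟ true) (vertices n)

step : List Vertex → List Vertex → List Vertex
step S R = filter (λ v → (memV v R ∨ anyB (λ u → adj u v) R) ≟ true) S

iter : ℕ → List Vertex → List Vertex → List Vertex
iter zero S R = R
iter (suc m) S R = iter m S (step S R)

connectedᵇ : List Vertex → Bool
connectedᵇ [] = false
connectedᵇ (v ∷ S) = allB (λ w → memV w (iter (length (v ∷ S)) (v ∷ S) (v ∷ []))) (v ∷ S)

-- labeling is surjective onto {0..k-1} and every block is nonempty and connected
validᵇ : ℕ → ℕ → List ℕ → Bool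
validᵇ k n l = allB (λ j → connectedᵇ (block n l j)) (upTo k)

-- Each division into k pieces corresponds to exactly k! valid labelings (label permutations),
-- so r k n = #(valid labelings) / k!.
r : ℕ → ℕ → ℕ
r k n = length (filter (λ l → validᵇ k n l ≟ true) (allLabelings k (2 * n))) / (k !)
  where instance _ = k !≢0

-- k ranges over 0 … 2n (no division has more than 2n pieces)
totalDivisions : ℕ → ℕ
totalDivisions n = sum (map (λ k → r k n) (upTo (suc (2 * n))))

totalPieces : ℕ → ℕ
totalPieces n = sum (map (λ k → k * r k n) (upTo (suc (2 * n))))

ratio : ℕ → ℕ → ℚ
ratio a zero = 0ℚ
ratio a (suc d) = (+ a) ℚ/ (suc d)

E : ℕ → ℚ
E n = ratio (totalPieces n) (totalDivisions n)

En/n : ℕ → ℚ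
En/n n = ratio (totalPieces n) (n * totalDivisions n)

-- comparisons with the (irrational) real number √a, for a rational a ≥ 0
-- x < √a
_<√_ : ℚ → ℚ → Set
x <√ a = (x < 0ℚ) ⊎ (x ℚ.* x < a)
_√<_ : ℚ → ℚ → Set
a √< x = (0ℚ < x) × (a < x ℚ.* x)

{-# OPTIONS --safe #-}
module Submission where

-- Adjacent equal labels lie in one piece, so a division of the strip is built column by column and
-- only two states matter: the two cells of the end column lie in the same piece or in different ones.
-- Adding a column turns the numbers sₖ, dₖ of such divisions into k pieces into
--   s′ₖ = sₖ + 2 dₖ + vₖ₋₁   and   d′ₖ = dₖ + 2 vₖ₋₁ + vₖ₋₂,   where v = s + d.
-- Summing over k gives S′ = 2 S + 3 D and D′ = 3 S + 4 D, whose matrix has eigenvalues 3 ± √10, and a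
-- linear recursion for the numbers of pieces, with closed form
--   20 (PS + PD) = n (22 S + 14 D) + 2 S + 22 D.
-- With δ = D / (S + D), 3/2 − Eₙ/n differs from 2/5 (1 + δ) by O(1/n), while the Pell invariant
-- 3 D² − 2 S D − 3 S² = ± 2 says that (2/5 (1 + δ))² differs from 2/5 by O(1 / (S + D)²).

-- Two obstacles shape the proof. First, what is counted are labelings, and a piece that ends in the
-- first column takes its label out of use. The recursion is therefore proved for every
-- duplicate-free alphabet; the choice of the departing label turns `(k - 1) !` into `k !`, so the
-- division by `k !` in `r` comes out exact by induction on the columns, without any action of
-- permutations. Secondly, the limit is irrational while all quantities are rational. No eigenvector
-- expansion is used. The closed form gives `Eₙ / n` = 11/10 - 2/5 δ + O(1/n), and 3/2 - 11/10 = 2/5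
-- leaves g = 2/5 (1 + δ) as the rational stand-in for the root: along the eigenvector of 3 + √10
-- one has δ = (√10 - 2)/2, hence g = √10/5 = √(2/5). Comparisons with the root are made by
-- squaring, and the bound g ≥ 3/5 turns a small error of g² into a small error of g.

open import Defs
open import Data.Bool as Bool using (Bool; true; false; _∧_; _∨_; not; _≟_)
open import Data.Bool.Properties using (∨-zeroʳ; ∨-identityʳ)
open import Data.List using (List; []; _∷_; _++_; _∷ʳ_; map; filter; length; upTo; concatMap)
open import Data.List.Membership.Propositional using (_∈_; _∉_; find)
open import Data.List.Membership.Propositional.Properties
  using (∈-filter⁺; ∈-filter⁻; ∈-upTo⁺; ∈-upTo⁻; ∈-map⁺; ∈-map⁻; ∈-++⁺ˡ; ∈-++⁺ʳ; ∈-++⁻; ∈-concatMap⁻)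
open import Data.List.Properties using (length-map; length-upTo; map-upTo; upTo-∷ʳ)
open import Data.List.Relation.Unary.All using (lookup)
open import Data.List.Relation.Unary.Any using (here; there)
open import Data.List.Relation.Unary.Unique.Propositional using (Unique; []; _∷_)
open import Data.List.Relation.Unary.Unique.Propositional.Properties using (filter⁺; upTo⁺)
open import Data.Nat as ℕ using (ℕ; zero; suc; z≤n; s≤s; _≤_; _≡ᵇ_)
open import Data.Nat.DivMod using (m*n/n≡m)
open import Data.Nat.ListAction using (sum)
import Data.Nat.Properties as ℕₚ
import Data.Nat.Tactic.RingSolver as ℕ-Solver
open import Data.Product using (_×_; _,_; ∃-syntax; proj₁; proj₂)
open import Data.Rational as ℚ using (ℚ; 0ℚ; 1ℚ; mkℚ; nonNegative; toℚᵘ)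
open import Data.Rational.Literals using (fromℤ)
open import Data.Rational.Properties as ℚₚ using (toℚᵘ-injective; toℚᵘ-homo-+; toℚᵘ-homo-*; toℚᵘ-fromℚᵘ)
open import Data.Rational.Solver using (module +-*-Solver)
import Data.Rational.Unnormalised as ℚᵘ
import Data.Rational.Unnormalised.Properties as ℚᵘₚ
open import Data.Sum using (_⊎_; inj₁; inj₂)
open import Function using (_∘_)
open import Relation.Binary.PropositionalEquality
open import Relation.Nullary using (¬_; ¬?; yes; no; contradiction)

private variable
  A B : Set

-- Connectedness in the ladder graph

∧-split : ∀ {a b} → a ∧ b ≡ true → a ≡ true × b ≡ true
∧-split {true} {true} refl = refl , refl

∨-split : ∀ {a b} → a ∨ b ≡ true → a ≡ true ⊎ b ≡ true
∨-split {true} _ = inj₁ refl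
∨-split {false} e = inj₂ e

∨-introˡ : ∀ {a} b → a ≡ true → a ∨ b ≡ true
∨-introˡ _ refl = refl

∨-introʳ : ∀ a {b} → b ≡ true → a ∨ b ≡ true
∨-introʳ a refl = ∨-zeroʳ a

false⇒¬ : ∀ {b} → b ≡ false → ¬ (b ≡ true)
false⇒¬ refl ()

≢true⇒false : ∀ {b} → ¬ (b ≡ true) → b ≡ false
≢true⇒false {false} _ = refl
≢true⇒false {true} h = contradiction refl h

bool-ext : ∀ {a b} → (a ≡ true → b ≡ true) → (b ≡ true → a ≡ true) → a ≡ b
bool-ext {true} f _ = sym (f refl)
bool-ext {false} {true} _ g = g refl
bool-ext {false} {false} _ _ = refl

≡ᵇ-sound : ∀ {m n} → (m ≡ᵇ n) ≡ true → m ≡ n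
≡ᵇ-sound {m} {n} e = ℕₚ.≡ᵇ⇒≡ m n (subst Bool.T (sym e) _)

≡ᵇ-refl : ∀ n → (n ≡ᵇ n) ≡ true
≡ᵇ-refl zero = refl
≡ᵇ-refl (suc n) = ≡ᵇ-refl n

eqV-sound : ∀ {u v} → eqV u v ≡ true → u ≡ v
eqV-sound e with ∧-split e
... | e₁ , e₂ = cong₂ _,_ (≡ᵇ-sound e₁) (≡ᵇ-sound e₂)

eqV-refl : ∀ v → eqV v v ≡ true
eqV-refl (a , b) rewrite ≡ᵇ-refl a = ≡ᵇ-refl b

anyB⁻ : ∀ {A : Set} {p : A → Bool} xs → anyB p xs ≡ true → ∃[ x ] (x ∈ xs × p x ≡ true)
anyB⁻ (x ∷ xs) e with ∨-split e
... | inj₁ px = x , here refl , px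
... | inj₂ e′ with anyB⁻ xs e′
...   | y , y∈ , py = y , there y∈ , py

anyB⁺ : ∀ {A : Set} {p : A → Bool} {x} {xs} → x ∈ xs → p x ≡ true → anyB p xs ≡ true
anyB⁺ {p = p} {xs = _ ∷ xs} (here refl) px = ∨-introˡ (anyB p xs) px
anyB⁺ {p = p} {xs = y ∷ _} (there x∈) px = ∨-introʳ (p y) (anyB⁺ x∈ px)

allB⁻ : ∀ {A : Set} {p : A → Bool} {xs} → allB p xs ≡ true → ∀ {x} → x ∈ xs → p x ≡ true
allB⁻ e (here refl) = proj₁ (∧-split e)
allB⁻ e (there x∈) = allB⁻ (proj₂ (∧-split e)) x∈

allB⁺ : ∀ {A : Set} {p : A → Bool} xs → (∀ {x} → x ∈ xs → p x ≡ true) → allB p xs ≡ true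
allB⁺ [] _ = refl
allB⁺ (x ∷ xs) h rewrite h (here refl) = allB⁺ xs (h ∘ there)

memV⁻ : ∀ {v} R → memV v R ≡ true → v ∈ R
memV⁻ R e with anyB⁻ R e
... | u , u∈ , eq = subst (_∈ R) (sym (eqV-sound eq)) u∈

memV⁺ : ∀ {v R} → v ∈ R → memV v R ≡ true
memV⁺ {v} v∈ = anyB⁺ v∈ (eqV-refl v)

-- As in `adj`, rows are not bounded: any two different rows of a column are adjacent. This makes
-- `column-path` a single edge.
data Adj : Vertex → Vertex → Set where
  vertical  : ∀ {r₁ r₂ c} → r₁ ≢ r₂ → Adj (r₁ , c) (r₂ , c)
  rightward : ∀ {r c} → Adj (r , c) (r , suc c)
  leftward  : ∀ {r c} → Adj (r , suc c) (r , c)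

adj-sound : ∀ u v → adj u v ≡ true → Adj u v
adj-sound (r₁ , c₁) (r₂ , c₂) e with ∨-split {(c₁ ≡ᵇ c₂) ∧ not (r₁ ≡ᵇ r₂)} e
... | inj₁ e′ with ∧-split e′
...   | c≡ , r≢ with refl ← ≡ᵇ-sound {c₁} {c₂} c≡ = vertical λ { refl → lem (≡ᵇ-refl r₁) r≢ }
  where lem : ∀ {b} → b ≡ true → ¬ (not b ≡ true)
        lem refl ()
adj-sound (r₁ , c₁) (r₂ , c₂) e | inj₂ e′ with ∧-split {r₁ ≡ᵇ r₂} e′
... | r≡ , e″ with refl ← ≡ᵇ-sound {r₁} {r₂} r≡ with ∨-split {suc c₁ ≡ᵇ c₂} e″
...   | inj₁ q with refl ← ≡ᵇ-sound {suc c₁} {c₂} q = rightward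
...   | inj₂ q with refl ← ≡ᵇ-sound {suc c₂} {c₁} q = leftward

adj-complete : ∀ {u v} → Adj u v → adj u v ≡ true
adj-complete (vertical {r₁} {r₂} {c} r≢)
  rewrite ≡ᵇ-refl c | ≢true⇒false {r₁ ≡ᵇ r₂} (r≢ ∘ ≡ᵇ-sound) = refl
adj-complete (rightward {r} {c}) rewrite ≡ᵇ-refl r | ≡ᵇ-refl c =
  ∨-zeroʳ _
adj-complete (leftward {r} {c}) rewrite ≡ᵇ-refl r | ≡ᵇ-refl c =
  ∨-introʳ ((suc c ≡ᵇ c) ∧ false) (∨-zeroʳ (suc (suc c) ≡ᵇ c))

Adj-sym : ∀ {u v} → Adj u v → Adj v u
Adj-sym (vertical r≢) = vertical (r≢ ∘ sym)
Adj-sym rightward = leftward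
Adj-sym leftward = rightward

infixr 5 _∷⟨_⟩_
data Path (P : Vertex → Set) : Vertex → Vertex → Set where
  stop    : ∀ {v} → P v → Path P v v
  _∷⟨_⟩_  : ∀ {u v w} → P u → Adj u v → Path P v w → Path P u w

_++ᵖ_ : ∀ {P u v w} → Path P u v → Path P v w → Path P u w
stop _ ++ᵖ q = q
(pu ∷⟨ a ⟩ p) ++ᵖ q = pu ∷⟨ a ⟩ (p ++ᵖ q)

source : ∀ {P u v} → Path P u v → P u
source (stop pu) = pu
source (pu ∷⟨ _ ⟩ _) = pu

target : ∀ {P u v} → Path P u v → P v
target (stop pv) = pv
target (_ ∷⟨ _ ⟩ p) = target p

reverseᵖ : ∀ {P u v} → Path P u v → Path P v u
reverseᵖ (stop pu) = stop pu
reverseᵖ (pu ∷⟨ a ⟩ p) = reverseᵖ p ++ᵖ (source p ∷⟨ Adj-sym a ⟩ stop pu)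

mapᵖ : ∀ {P Q : Vertex → Set} → (∀ {v} → P v → Q v) → ∀ {u v} → Path P u v → Path Q u v
mapᵖ f (stop pu) = stop (f pu)
mapᵖ f (pu ∷⟨ a ⟩ p) = f pu ∷⟨ a ⟩ mapᵖ f p

-- Inhabitation is included because `connectedᵇ []` is false; this is what forces every label to be
-- used.
Connected : (Vertex → Set) → Set
Connected P = (∃[ v ] P v) × (∀ {v w} → P v → P w → Path P v w)

step⁻ : ∀ {v} S R → v ∈ step S R → v ∈ S × (v ∈ R ⊎ ∃[ u ] (u ∈ R × Adj u v))
step⁻ {v} S R v∈ with ∈-filter⁻ (λ v → (memV v R ∨ anyB (λ u → adj u v) R) ≟ true) {xs = S} v∈
... | v∈S , e with ∨-split {memV v R} e
...   | inj₁ m = v∈S , inj₁ (memV⁻ R m)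
...   | inj₂ a with anyB⁻ R a
...     | u , u∈ , e′ = v∈S , inj₂ (u , u∈ , adj-sound u v e′)

step⁺ : ∀ {v} S R → v ∈ S → v ∈ R ⊎ ∃[ u ] (u ∈ R × Adj u v) → v ∈ step S R
step⁺ S R v∈S h = ∈-filter⁺ (λ v → (memV v R ∨ anyB (λ u → adj u v) R) ≟ true) v∈S (lem h)
  where
  lem : ∀ {v} → v ∈ R ⊎ ∃[ u ] (u ∈ R × Adj u v) → (memV v R ∨ anyB (λ u → adj u v) R) ≡ true
  lem {v} (inj₁ v∈R) = ∨-introˡ (anyB (λ u → adj u v) R) (memV⁺ v∈R)
  lem {v} (inj₂ (u , u∈ , a)) = ∨-introʳ (memV v R) (anyB⁺ u∈ (adj-complete a))

iter-sound : ∀ m S R {v} → (∀ {w} → w ∈ R → Path (_∈ S) v w) → ∀ {w} → w ∈ iter m S R → Path (_∈ S) v w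
iter-sound zero S R h w∈ = h w∈
iter-sound (suc m) S R {v} h w∈ = iter-sound m S (step S R) h′ w∈
  where
  h′ : ∀ {w} → w ∈ step S R → Path (_∈ S) v w
  h′ w∈ with step⁻ S R w∈
  ... | _ , inj₁ w∈R = h w∈R
  ... | w∈S , inj₂ (u , u∈ , a) = h u∈ ++ᵖ (target (h u∈) ∷⟨ a ⟩ stop w∈S)

missing : List Vertex → List Vertex → ℕ
missing [] R = 0
missing (v ∷ S) R with memV v R
... | true = missing S R
... | false = suc (missing S R)

missing-mono : ∀ S {R R′} → (∀ {v} → v ∈ S → v ∈ R → v ∈ R′) → missing S R′ ℕ.≤ missing S R
missing-mono [] _ = z≤n
missing-mono (v ∷ S) {R} {R′} h with memV v R in e | memV v R′ in e′
... | true  | true  = missing-mono S (h ∘ there)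
... | true  | false = contradiction (memV⁺ (h (here refl) (memV⁻ R e))) (false⇒¬ e′)
... | false | true  = ℕₚ.m≤n⇒m≤1+n (missing-mono S (h ∘ there))
... | false | false = s≤s (missing-mono S (h ∘ there))

missing-strict : ∀ S {R R′} → (∀ {v} → v ∈ S → v ∈ R → v ∈ R′) →
                 ∀ {w} → w ∈ S → w ∉ R → w ∈ R′ → missing S R′ ℕ.< missing S R
missing-strict (v ∷ S) {R} {R′} h w∈S w∉R w∈R′ with memV v R in e | memV v R′ in e′ | w∈S
... | true  | _     | here refl = contradiction (memV⁻ R e) w∉R
... | _     | false | here refl = contradiction (memV⁺ w∈R′) (false⇒¬ e′)
... | false | true  | here refl = s≤s (missing-mono S (h ∘ there))
... | true  | true  | there w∈ = missing-strict S (h ∘ there) w∈ w∉R w∈R′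
... | true  | false | there _  = contradiction (memV⁺ (h (here refl) (memV⁻ R e))) (false⇒¬ e′)
... | false | true  | there w∈ = ℕₚ.m≤n⇒m≤1+n (missing-strict S (h ∘ there) w∈ w∉R w∈R′)
... | false | false | there w∈ = s≤s (missing-strict S (h ∘ there) w∈ w∉R w∈R′)

missing≡0 : ∀ S {R} → missing S R ≡ 0 → ∀ {v} → v ∈ S → v ∈ R
missing≡0 (v ∷ S) {R} e v∈ with memV v R in eq | v∈
... | true | here refl = memV⁻ R eq
... | true | there v∈′ = missing≡0 S e v∈′

missing≤length : ∀ S R → missing S R ℕ.≤ length S
missing≤length [] R = z≤n
missing≤length (v ∷ S) R with memV v R
... | true = ℕₚ.m≤n⇒m≤1+n (missing≤length S R)
... | false = s≤s (missing≤length S R)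

iter-extensive : ∀ m S {R v} → v ∈ S → v ∈ R → v ∈ iter m S R
iter-extensive zero S _ v∈R = v∈R
iter-extensive (suc m) S {R} v∈S v∈R = iter-extensive m S v∈S (step⁺ S R v∈S (inj₁ v∈R))

closed-path : ∀ {S R} → (∀ {w} → w ∈ step S R → w ∈ R) →
              ∀ {v w} → v ∈ R → Path (_∈ S) v w → w ∈ R
closed-path cl v∈ (stop _) = v∈
closed-path {S} {R} cl v∈ (_ ∷⟨ a ⟩ p) =
  closed-path cl (cl (step⁺ S R (source p) (inj₂ (_ , v∈ , a)))) p

-- Each step that is not yet a fixed point adds a vertex of S, so m ≥ missing S R steps saturate.
iter-complete : ∀ m S R → missing S R ℕ.≤ m →
                ∀ {v w} → v ∈ R → Path (_∈ S) v w → w ∈ iter m S R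
iter-complete zero S R le v∈ p = missing≡0 S (ℕₚ.n≤0⇒n≡0 le) (target p)
iter-complete (suc m) S R le {v} {w} v∈ p with missing S (step S R) ℕ.<? missing S R
... | yes lt = iter-complete m S (step S R) (ℕ.s≤s⁻¹ (ℕₚ.≤-trans lt le))
                 (step⁺ S R (source p) (inj₁ v∈)) p
-- The count did not drop, so the step added nothing: `R` is already closed and contains the whole
-- path.
... | no ¬lt = iter-extensive (suc m) S (target p) (closed-path cl v∈ p)
  where
  cl : ∀ {u} → u ∈ step S R → u ∈ R
  cl {u} u∈ with memV u R in e
  ... | true = memV⁻ R e
  ... | false = contradiction
          (missing-strict S (λ x∈S x∈R → step⁺ S R x∈S (inj₁ x∈R)) (proj₁ (step⁻ S R u∈))
            (false⇒¬ e ∘ memV⁺) u∈) ¬lt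

connectedᵇ-sound : ∀ S → connectedᵇ S ≡ true → Connected (_∈ S)
connectedᵇ-sound (v ∷ S) e = (v , here refl) , λ x∈ y∈ → reverseᵖ (reach x∈) ++ᵖ reach y∈
  where
  reach : ∀ {w} → w ∈ v ∷ S → Path (_∈ v ∷ S) v w
  reach w∈ = iter-sound (length (v ∷ S)) (v ∷ S) (v ∷ []) (λ { (here refl) → stop (here refl) })
               (memV⁻ _ (allB⁻ e w∈))

connectedᵇ-complete : ∀ S → Connected (_∈ S) → connectedᵇ S ≡ true
connectedᵇ-complete [] ((_ , ()) , _)
connectedᵇ-complete (v ∷ S) (_ , path) = allB⁺ (v ∷ S) λ w∈ →
  memV⁺ (iter-complete (length (v ∷ S)) (v ∷ S) (v ∷ []) (missing≤length (v ∷ S) (v ∷ []))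
    (here refl) (path (here refl) w∈))

-- Column-by-column connectedness

inRow : Bool × Bool → ℕ → Bool
inRow (x , y) 0 = x
inRow (x , y) 1 = y
inRow (x , y) (suc (suc _)) = false

cell : List (Bool × Bool) → Vertex → Bool
cell [] _ = false
cell (x ∷ _) (r , zero) = inRow x r
cell (_ ∷ xs) (r , suc c) = cell xs (r , c)

Cell : List (Bool × Bool) → Vertex → Set
Cell xs v = cell xs v ≡ true

emptyᵇ : List (Bool × Bool) → Bool
emptyᵇ [] = true
emptyᵇ ((x , y) ∷ xs) = not x ∧ (not y ∧ emptyᵇ xs)

attached : Bool × Bool → List (Bool × Bool) → Bool
attached _ [] = false
attached (x , y) ((x′ , y′) ∷ _) = (x ∧ x′) ∨ (y ∧ y′)

-- Two cells of one column are always adjacent, so only the horizontal contact of a nonempty column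
-- with the next one needs checking. A gap inside the set is rejected because `attached` fails at an
-- empty next column.
conn : List (Bool × Bool) → Bool
conn [] = false
conn ((false , false) ∷ xs) = conn xs
conn (c ∷ xs) = emptyᵇ xs ∨ (conn xs ∧ attached c xs)

emptyᵇ-sound : ∀ xs → emptyᵇ xs ≡ true → ∀ v → ¬ Cell xs v
emptyᵇ-sound ((false , false) ∷ xs) e (0 , 0) ()
emptyᵇ-sound ((false , false) ∷ xs) e (1 , 0) ()
emptyᵇ-sound ((false , false) ∷ xs) e (suc (suc _) , 0) ()
emptyᵇ-sound ((false , false) ∷ xs) e (r , suc c) = emptyᵇ-sound xs e (r , c)

nonempty : ∀ xs → emptyᵇ xs ≡ false → ∃[ v ] Cell xs v
nonempty ((true , y) ∷ xs) e = (0 , 0) , refl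
nonempty ((false , true) ∷ xs) e = (1 , 0) , refl
nonempty ((false , false) ∷ xs) e with nonempty xs e
... | (r , c) , h = (r , suc c) , h

row<2 : ∀ xs {r c} → Cell xs (r , c) → r ≡ 0 ⊎ r ≡ 1
row<2 (_ ∷ xs) {0} {zero} _ = inj₁ refl
row<2 (_ ∷ xs) {1} {zero} _ = inj₂ refl
row<2 (_ ∷ xs) {r} {suc c} h = row<2 xs h

shiftᵖ : ∀ {x xs r c r′ c′} → Path (Cell xs) (r , c) (r′ , c′) →
        Path (Cell (x ∷ xs)) (r , suc c) (r′ , suc c′)
shiftᵖ (stop h) = stop h
shiftᵖ (h ∷⟨ vertical r≢ ⟩ p) = h ∷⟨ vertical r≢ ⟩ shiftᵖ p
shiftᵖ (h ∷⟨ rightward ⟩ p) = h ∷⟨ rightward ⟩ shiftᵖ p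
shiftᵖ (h ∷⟨ leftward ⟩ p) = h ∷⟨ leftward ⟩ shiftᵖ p

column-path : ∀ xs {r r′ c} → Cell xs (r , c) → Cell xs (r′ , c) → Path (Cell xs) (r , c) (r′ , c)
column-path xs {r} {r′} h h′ with r ℕ.≟ r′
... | yes refl = stop h
... | no r≢ = h ∷⟨ vertical r≢ ⟩ stop h′

attached-sound : ∀ {x xs} → attached x xs ≡ true →
                 ∃[ r ] (Cell (x ∷ xs) (r , 0) × Cell (x ∷ xs) (r , 1))
attached-sound {true , _} {(true , _) ∷ _} _ = 0 , refl , refl
attached-sound {true , true} {(false , true) ∷ _} _ = 1 , refl , refl
attached-sound {false , true} {(_ , true) ∷ _} _ = 1 , refl , refl

attached-complete : ∀ {x xs r} → Cell (x ∷ xs) (r , 0) → Cell (x ∷ xs) (r , 1) → attached x xs ≡ true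
attached-complete {true , _} {(true , _) ∷ _} {0} _ _ = refl
attached-complete {x , true} {(x′ , true) ∷ _} {1} _ _ = ∨-zeroʳ (x ∧ x′)

-- A path that ends to the right of the first column can be pushed off that column:
-- an excursion into it only ever moves between the two cells of the second column.
project : ∀ {x xs r c r′ c′} → Path (Cell (x ∷ xs)) (r , suc c) (r′ , suc c′) →
          Path (Cell xs) (r , c) (r′ , c′)
projectˡ : ∀ {x xs r r′ c′} → Path (Cell (x ∷ xs)) (r , 0) (r′ , suc c′) →
           ∃[ r″ ] (Cell (x ∷ xs) (r″ , 0) × Path (Cell xs) (r″ , 0) (r′ , c′))
project (stop h) = stop h
project (h ∷⟨ vertical r≢ ⟩ p) = h ∷⟨ vertical r≢ ⟩ project p
project (h ∷⟨ rightward ⟩ p) = h ∷⟨ rightward ⟩ project p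
project {xs = xs} {c = zero} (h ∷⟨ leftward ⟩ p) with projectˡ p
... | _ , _ , q = column-path xs h (source q) ++ᵖ q
project {c = suc c} (h ∷⟨ leftward ⟩ p) = h ∷⟨ leftward ⟩ project p
projectˡ (h ∷⟨ vertical r≢ ⟩ p) = projectˡ p
projectˡ {r = r} (h ∷⟨ rightward ⟩ p) = r , h , project p

Connected-tail : ∀ {x xs v} → Cell xs v → Connected (Cell (x ∷ xs)) → Connected (Cell xs)
Connected-tail {v = v} h (_ , path) = (v , h) , λ a b → project (path a b)

Connected-attached : ∀ {x xs r v} → Cell (x ∷ xs) (r , 0) → Cell xs v →
                     Connected (Cell (x ∷ xs)) → attached x xs ≡ true
Connected-attached {x} {xs} {r} {v} h h′ (_ , path)
  with projectˡ (path {r , 0} {proj₁ v , suc (proj₂ v)} h h′)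
... | r″ , a , q = attached-complete {x} {xs} {r″} a (source q)

-- The last clause of `conn` under a name of its own: `conn` computes only after a split on the
-- first column, and this lets its nonempty shapes share one argument.
conn-join : Bool × Bool → List (Bool × Bool) → Bool
conn-join x xs = emptyᵇ xs ∨ (conn xs ∧ attached x xs)

Connected-join : ∀ {x xs r} → Cell (x ∷ xs) (r , 0) →
                 (emptyᵇ xs ≡ true ⊎ (Connected (Cell xs) × attached x xs ≡ true)) →
                 Connected (Cell (x ∷ xs))
Connected-join {x} {xs} {r} h (inj₁ e) = ((r , 0) , h) , path
  where
  path : ∀ {v w} → Cell (x ∷ xs) v → Cell (x ∷ xs) w → Path (Cell (x ∷ xs)) v w
  path {_ , zero} {_ , zero} a b = column-path (x ∷ xs) a b
  path {r , suc c} a _ = contradiction a (emptyᵇ-sound xs e (r , c))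
  path {_ , zero} {r , suc c} _ b = contradiction b (emptyᵇ-sound xs e (r , c))
Connected-join {x} {xs} {r} h (inj₂ ((_ , path) , e)) with attached-sound {x} {xs} e
... | r₀ , a₀ , a₁ = ((r , 0) , h) , λ a b → reverseᵖ (hub a) ++ᵖ hub b
  where
  -- In row `r₀` the first two columns are both occupied, so every cell can be reached from
  -- `(r₀ , 0)`, the cells further right through `(r₀ , 1)`.
  hub : ∀ {v} → Cell (x ∷ xs) v → Path (Cell (x ∷ xs)) (r₀ , 0) v
  hub {_ , zero} a = column-path (x ∷ xs) a₀ a
  hub {_ , suc c} a = a₀ ∷⟨ rightward ⟩ shiftᵖ (path a₁ a)

Connected-join⁻ : ∀ {x xs r} → Cell (x ∷ xs) (r , 0) → Connected (Cell (x ∷ xs)) →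
                  emptyᵇ xs ≡ true ⊎ (Connected (Cell xs) × attached x xs ≡ true)
Connected-join⁻ {x} {xs} {r} h C with emptyᵇ xs in e
... | true = inj₁ refl
... | false with nonempty xs e
...   | _ , h′ = inj₂ (Connected-tail h′ C , Connected-attached {r = r} h h′ C)

conn-sound : ∀ xs → conn xs ≡ true → Connected (Cell xs)
conn-sound-join : ∀ x xs → conn-join x xs ≡ true →
                  emptyᵇ xs ≡ true ⊎ (Connected (Cell xs) × attached x xs ≡ true)
conn-sound-join x xs e with ∨-split {emptyᵇ xs} e
... | inj₁ h = inj₁ h
... | inj₂ h with ∧-split {conn xs} h
...   | h₁ , h₂ = inj₂ (conn-sound xs h₁ , h₂)
conn-sound ((false , false) ∷ xs) e with conn-sound xs e
... | ((r , c) , h) , path = ((r , suc c) , h) , path′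
  where
  path′ : ∀ {v w} → Cell ((false , false) ∷ xs) v → Cell ((false , false) ∷ xs) w →
          Path (Cell ((false , false) ∷ xs)) v w
  path′ {0 , zero} ()
  path′ {1 , zero} ()
  path′ {suc (suc _) , zero} ()
  path′ {_ , suc _} {0 , zero} _ ()
  path′ {_ , suc _} {1 , zero} _ ()
  path′ {_ , suc _} {suc (suc _) , zero} _ ()
  path′ {_ , suc _} {_ , suc _} a b = shiftᵖ (path a b)
conn-sound ((true , y) ∷ xs) e = Connected-join {r = 0} refl (conn-sound-join (true , y) xs e)
conn-sound ((false , true) ∷ xs) e = Connected-join {r = 1} refl (conn-sound-join (false , true) xs e)

conn-complete : ∀ xs → Connected (Cell xs) → conn xs ≡ true
conn-complete-join : ∀ x xs → emptyᵇ xs ≡ true ⊎ (Connected (Cell xs) × attached x xs ≡ true) →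
                     conn-join x xs ≡ true
conn-complete-join x xs (inj₁ e) = ∨-introˡ _ e
conn-complete-join x xs (inj₂ (C , e)) rewrite conn-complete xs C | e = ∨-zeroʳ (emptyᵇ xs)
conn-complete [] ((_ , ()) , _)
conn-complete ((true , y) ∷ xs) C = conn-complete-join (true , y) xs (Connected-join⁻ {r = 0} refl C)
conn-complete ((false , true) ∷ xs) C = conn-complete-join (false , true) xs (Connected-join⁻ {r = 1} refl C)
conn-complete ((false , false) ∷ xs) C@(((0 , zero) , ()) , _)
conn-complete ((false , false) ∷ xs) C@(((1 , zero) , ()) , _)
conn-complete ((false , false) ∷ xs) C@(((suc (suc _) , zero) , ()) , _)
conn-complete ((false , false) ∷ xs) C@(((r , suc c) , h) , _) = conn-complete xs (Connected-tail h C)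

-- Labelings read column by column

Columns : Set
Columns = List (ℕ × ℕ)

indicator : ℕ → Columns → List (Bool × Bool)
indicator j = map λ (t , b) → (t ≡ᵇ j) , (b ≡ᵇ j)

-- Top row first, then bottom row, as the index `r * n + c` in `label` demands.
flatten : Columns → List ℕ
flatten u = map proj₁ u ++ map proj₂ u

nth-++ˡ : ∀ {xs ys c} → c ℕ.< length xs → nth (xs ++ ys) c ≡ nth xs c
nth-++ˡ {x ∷ xs} {c = zero} _ = refl
nth-++ˡ {x ∷ xs} {c = suc c} (s≤s lt) = nth-++ˡ {xs} lt

nth-++ʳ : ∀ xs {ys} c → nth (xs ++ ys) (length xs ℕ.+ c) ≡ nth ys c
nth-++ʳ [] c = refl
nth-++ʳ (_ ∷ xs) c = nth-++ʳ xs c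

label-top : ∀ u {c} → c ℕ.< length u → label (length u) (flatten u) (0 , c) ≡ nth (map proj₁ u) c
label-top u lt = nth-++ˡ {map proj₁ u} (subst (_ ℕ.<_) (sym (length-map proj₁ u)) lt)

label-bot : ∀ u c → label (length u) (flatten u) (1 , c) ≡ nth (map proj₂ u) c
label-bot u c = trans (cong (λ m → nth (flatten u) (m ℕ.+ c))
                   (trans (ℕₚ.*-identityˡ (length u)) (sym (length-map proj₁ u))))
                 (nth-++ʳ (map proj₁ u) c)

cell-top : ∀ j u {c} → c ℕ.< length u → cell (indicator j u) (0 , c) ≡ (nth (map proj₁ u) c ≡ᵇ j)
cell-top j (_ ∷ u) {zero} _ = refl
cell-top j (_ ∷ u) {suc c} (s≤s lt) = cell-top j u lt

cell-bot : ∀ j u {c} → c ℕ.< length u → cell (indicator j u) (1 , c) ≡ (nth (map proj₂ u) c ≡ᵇ j)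
cell-bot j (_ ∷ u) {zero} _ = refl
cell-bot j (_ ∷ u) {suc c} (s≤s lt) = cell-bot j u lt

cell⇒column< : ∀ j u {r c} → Cell (indicator j u) (r , c) → c ℕ.< length u
cell⇒column< j (_ ∷ u) {c = zero} _ = s≤s z≤n
cell⇒column< j (_ ∷ u) {r} {suc c} h = s≤s (cell⇒column< j u {r} h)

∈-vertices⁻ : ∀ n {v} → v ∈ vertices n → (∃[ c ] (c ℕ.< n × v ≡ (0 , c))) ⊎ (∃[ c ] (c ℕ.< n × v ≡ (1 , c)))
∈-vertices⁻ n v∈ with ∈-++⁻ (map (0 ,_) (upTo n)) v∈
... | inj₁ h with ∈-map⁻ (0 ,_) h
...   | c , c∈ , e = inj₁ (c , ∈-upTo⁻ c∈ , e)
∈-vertices⁻ n v∈ | inj₂ h with ∈-++⁻ (map (1 ,_) (upTo n)) h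
... | inj₁ h′ with ∈-map⁻ (1 ,_) h′
...   | c , c∈ , e = inj₂ (c , ∈-upTo⁻ c∈ , e)

block⁻ : ∀ j u {v} → v ∈ block (length u) (flatten u) j → Cell (indicator j u) v
block⁻ j u v∈ with ∈-filter⁻ (λ v → (label (length u) (flatten u) v ≡ᵇ j) ≟ true) {xs = vertices (length u)} v∈
... | v∈V , e with ∈-vertices⁻ (length u) v∈V
...   | inj₁ (c , lt , refl) = trans (cell-top j u lt) (trans (cong (_≡ᵇ j) (sym (label-top u lt))) e)
...   | inj₂ (c , lt , refl) = trans (cell-bot j u lt) (trans (cong (_≡ᵇ j) (sym (label-bot u c))) e)

block⁺ : ∀ j u {v} → Cell (indicator j u) v → v ∈ block (length u) (flatten u) j
block⁺ j u {r , c} h with row<2 (indicator j u) {r} {c} h | cell⇒column< j u {r} h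
... | inj₁ refl | lt = ∈-filter⁺ (λ v → (label (length u) (flatten u) v ≡ᵇ j) ≟ true)
        (∈-++⁺ˡ (∈-map⁺ (0 ,_) (∈-upTo⁺ lt)))
        (trans (cong (_≡ᵇ j) (label-top u lt)) (trans (sym (cell-top j u lt)) h))
... | inj₂ refl | lt = ∈-filter⁺ (λ v → (label (length u) (flatten u) v ≡ᵇ j) ≟ true)
        (∈-++⁺ʳ (map (0 ,_) (upTo (length u))) (∈-++⁺ˡ (∈-map⁺ (1 ,_) (∈-upTo⁺ lt))))
        (trans (cong (_≡ᵇ j) (label-bot u c)) (trans (sym (cell-bot j u lt)) h))

Connected-resp : ∀ {P Q : Vertex → Set} → (∀ {v} → P v → Q v) → (∀ {v} → Q v → P v) →
                 Connected P → Connected Q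
Connected-resp f g ((v , pv) , path) = (v , f pv) , λ a b → mapᵖ f (path (g a) (g b))

-- The bridge from the reachability search to the column recursion; the counting below works with
-- `conn` alone.
connectedᵇ-block : ∀ j u → connectedᵇ (block (length u) (flatten u) j) ≡ conn (indicator j u)
connectedᵇ-block j u = bool-ext
  (λ e → conn-complete (indicator j u) (Connected-resp (block⁻ j u) (block⁺ j u) (connectedᵇ-sound _ e)))
  (λ e → connectedᵇ-complete _ (Connected-resp (block⁺ j u) (block⁻ j u) (conn-sound (indicator j u) e)))

module Counting where

  open import Data.Nat using (_+_; _*_; _!)
  open ℕ-Solver using (solve-∀)

  -- Sums over lists and enumeration of labelings

  -- Conditions are counted as 0/1 weights: conjunctions become products, exclusive alternatives
  -- become sums, and the counting reduces to rearranging sums.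
  χ : Bool → ℕ
  χ true = 1
  χ false = 0

  ∑ : List A → (A → ℕ) → ℕ
  ∑ [] f = 0
  ∑ (x ∷ xs) f = f x + ∑ xs f

  ∑-cong : ∀ (xs : List A) {f g} → (∀ {x} → x ∈ xs → f x ≡ g x) → ∑ xs f ≡ ∑ xs g
  ∑-cong [] h = refl
  ∑-cong (x ∷ xs) h = cong₂ _+_ (h (here refl)) (∑-cong xs (h ∘ there))

  ∑-zero : ∀ (xs : List A) → ∑ xs (λ _ → 0) ≡ 0
  ∑-zero [] = refl
  ∑-zero (x ∷ xs) = ∑-zero xs

  ∑-+ : ∀ (xs : List A) (f g : A → ℕ) → ∑ xs (λ x → f x + g x) ≡ ∑ xs f + ∑ xs g
  ∑-+ [] f g = refl
  ∑-+ (x ∷ xs) f g rewrite ∑-+ xs f g = lem (f x) (g x) (∑ xs f) (∑ xs g)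
    where lem : ∀ a b c d → a + b + (c + d) ≡ a + c + (b + d)
          lem = solve-∀

  ∑-*ˡ : ∀ (xs : List A) c (f : A → ℕ) → ∑ xs (λ x → c * f x) ≡ c * ∑ xs f
  ∑-*ˡ [] c f = sym (ℕₚ.*-zeroʳ c)
  ∑-*ˡ (x ∷ xs) c f rewrite ∑-*ˡ xs c f = sym (ℕₚ.*-distribˡ-+ c (f x) (∑ xs f))

  ∑-*ʳ : ∀ (xs : List A) c (f : A → ℕ) → ∑ xs (λ x → f x * c) ≡ ∑ xs f * c
  ∑-*ʳ xs c f = trans (∑-cong xs λ {x} _ → ℕₚ.*-comm (f x) c)
                  (trans (∑-*ˡ xs c f) (ℕₚ.*-comm c (∑ xs f)))

  ∑-const : ∀ (xs : List A) c → ∑ xs (λ _ → c) ≡ length xs * c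
  ∑-const [] c = refl
  ∑-const (x ∷ xs) c = cong (c +_) (∑-const xs c)

  ∑-swap : ∀ (xs : List A) (ys : List B) (f : A → B → ℕ) → ∑ xs (λ x → ∑ ys (λ y → f x y)) ≡ ∑ ys (λ y → ∑ xs (λ x → f x y))
  ∑-swap [] ys f = sym (∑-zero ys)
  ∑-swap (x ∷ xs) ys f rewrite ∑-swap xs ys f = sym (∑-+ ys (f x) (λ y → ∑ xs (λ x → f x y)))

  ∑-++ : ∀ (xs ys : List A) (f : A → ℕ) → ∑ (xs ++ ys) f ≡ ∑ xs f + ∑ ys f
  ∑-++ [] ys f = refl
  ∑-++ (x ∷ xs) ys f rewrite ∑-++ xs ys f = sym (ℕₚ.+-assoc (f x) (∑ xs f) (∑ ys f))

  ∑-map : ∀ (h : A → B) xs f → ∑ (map h xs) f ≡ ∑ xs (f ∘ h)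
  ∑-map h [] f = refl
  ∑-map h (x ∷ xs) f = cong (f (h x) +_) (∑-map h xs f)

  ∑-concatMap : ∀ (h : A → List B) xs f → ∑ (concatMap h xs) f ≡ ∑ xs (λ x → ∑ (h x) f)
  ∑-concatMap h [] f = refl
  ∑-concatMap h (x ∷ xs) f = trans (∑-++ (h x) (concatMap h xs) f) (cong (∑ (h x) f +_) (∑-concatMap h xs f))

  length-filter-χ : ∀ (p : A → Bool) xs → length (filter (λ x → p x ≟ true) xs) ≡ ∑ xs (χ ∘ p)
  length-filter-χ p [] = refl
  length-filter-χ p (x ∷ xs) with p x
  ... | true = cong suc (length-filter-χ p xs)
  ... | false = length-filter-χ p xs

  χ-∧ : ∀ a b → χ (a ∧ b) ≡ χ a * χ b
  χ-∧ true b = sym (ℕₚ.+-identityʳ (χ b))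
  χ-∧ false b = refl

  -- The hypothesis makes the two alternatives exclusive. It is applied with `e` emptiness and `c`
  -- connectedness of the same set.
  χ-join : ∀ e c a → (e ≡ true → c ≡ false) → χ (e ∨ (c ∧ a)) ≡ χ e + χ a * χ c
  χ-join true c a h rewrite h refl | ℕₚ.*-zeroʳ (χ a) = refl
  χ-join false c a h = trans (χ-∧ c a) (ℕₚ.*-comm (χ c) (χ a))

  ≡ᵇ-false : ∀ {m n} → m ≢ n → (m ≡ᵇ n) ≡ false
  ≡ᵇ-false m≢n = ≢true⇒false (m≢n ∘ ≡ᵇ-sound)

  ≡ᵇ-sym : ∀ m n → (m ≡ᵇ n) ≡ (n ≡ᵇ m)
  ≡ᵇ-sym zero zero = refl
  ≡ᵇ-sym zero (suc n) = refl
  ≡ᵇ-sym (suc m) zero = refl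
  ≡ᵇ-sym (suc m) (suc n) = ≡ᵇ-sym m n

  infixl 6 _∖_
  _∖_ : List ℕ → ℕ → List ℕ
  L ∖ t = filter (λ x → ¬? (x ℕ.≟ t)) L

  ∑-∖ : ∀ L t (f : ℕ → ℕ) → ∑ L (λ x → χ (not (x ≡ᵇ t)) * f x) ≡ ∑ (L ∖ t) f
  ∑-∖ [] t f = refl
  ∑-∖ (x ∷ L) t f with x ℕ.≟ t
  ... | yes refl rewrite ≡ᵇ-refl t = ∑-∖ L t f
  ... | no x≢t rewrite ≡ᵇ-false x≢t = cong₂ _+_ (ℕₚ.+-identityʳ (f x)) (∑-∖ L t f)

  ∑-pick : ∀ {L a} → Unique L → a ∈ L → ∀ (f : ℕ → ℕ) → ∑ L (λ x → χ (a ≡ᵇ x) * f x) ≡ f a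
  ∑-pick {x ∷ L} (x∉ ∷ _) (here refl) f rewrite ≡ᵇ-refl x = begin
    f x + 0 + ∑ L (λ y → χ (x ≡ᵇ y) * f y) ≡⟨ cong₂ _+_ (ℕₚ.+-identityʳ (f x))
                                                (∑-cong L λ {y} y∈ → cong (λ b → χ b * f y) (≡ᵇ-false (lookup x∉ y∈))) ⟩
    f x + ∑ L (λ _ → 0)                    ≡⟨ cong (f x +_) (∑-zero L) ⟩
    f x + 0                                ≡⟨ ℕₚ.+-identityʳ (f x) ⟩
    f x                                    ∎
    where open ≡-Reasoning
  ∑-pick {x ∷ L} (x∉ ∷ uq) (there a∈) f rewrite ≡ᵇ-false (≢-sym (lookup x∉ a∈)) = ∑-pick uq a∈ f

  ∈-∖⁻ : ∀ L {t x} → x ∈ L ∖ t → x ∈ L × x ≢ t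
  ∈-∖⁻ L {t} = ∈-filter⁻ (λ x → ¬? (x ℕ.≟ t)) {xs = L}

  ∈-∖⁺ : ∀ {L t x} → x ∈ L → x ≢ t → x ∈ L ∖ t
  ∈-∖⁺ {t = t} = ∈-filter⁺ (λ x → ¬? (x ℕ.≟ t))

  Unique-∖ : ∀ {L} t → Unique L → Unique (L ∖ t)
  Unique-∖ t = filter⁺ (λ x → ¬? (x ℕ.≟ t))

  length-∖ : ∀ {L t} → Unique L → t ∈ L → length L ≡ suc (length (L ∖ t))
  length-∖ {L} {t} uq t∈ = begin
    length L                                                     ≡⟨ count L ⟨
    ∑ L (λ _ → 1)                                                ≡⟨ ∑-cong L (λ {x} _ → split x) ⟩
    ∑ L (λ x → χ (t ≡ᵇ x) * 1 + χ (not (x ≡ᵇ t)) * 1)            ≡⟨ ∑-+ L _ _ ⟩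
    ∑ L (λ x → χ (t ≡ᵇ x) * 1) + ∑ L (λ x → χ (not (x ≡ᵇ t)) * 1) ≡⟨ cong₂ _+_ (∑-pick uq t∈ (λ _ → 1)) (∑-∖ L t (λ _ → 1)) ⟩
    suc (∑ (L ∖ t) (λ _ → 1))                                    ≡⟨ cong suc (count (L ∖ t)) ⟩
    suc (length (L ∖ t))                                         ∎
    where
    open ≡-Reasoning
    count : ∀ M → ∑ M (λ _ → 1) ≡ length M
    count M = trans (∑-const M 1) (ℕₚ.*-identityʳ (length M))
    split : ∀ x → 1 ≡ χ (t ≡ᵇ x) * 1 + χ (not (x ≡ᵇ t)) * 1
    split x rewrite ≡ᵇ-sym t x with x ≡ᵇ t
    ... | true = refl
    ... | false = refl

  columns : List ℕ → ℕ → List Columns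
  columns L zero = [] ∷ []
  columns L (suc n) = concatMap (λ t → concatMap (λ b → map ((t , b) ∷_) (columns L n)) L) L

  ∑-columns-suc : ∀ L n f → ∑ (columns L (suc n)) f ≡
                  ∑ L (λ t → ∑ L (λ b → ∑ (columns L n) (λ u → f ((t , b) ∷ u))))
  ∑-columns-suc L n f = trans (∑-concatMap _ L f) (∑-cong L λ {t} _ →
    trans (∑-concatMap (λ b → map ((t , b) ∷_) (columns L n)) L f) (∑-cong L λ {b} _ → ∑-map ((t , b) ∷_) (columns L n) f))

  columns-∷⁻ : ∀ L n {u} → u ∈ columns L (suc n) →
               ∃[ t ] ∃[ b ] ∃[ u′ ] (u ≡ (t , b) ∷ u′ × t ∈ L × b ∈ L × u′ ∈ columns L n)
  columns-∷⁻ L n u∈ with find (∈-concatMap⁻ (λ t → concatMap (λ b → map ((t , b) ∷_) (columns L n)) L) {xs = L} u∈)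
  ... | t , t∈ , h with find (∈-concatMap⁻ (λ b → map ((t , b) ∷_) (columns L n)) {xs = L} h)
  ...   | b , b∈ , h′ with ∈-map⁻ ((t , b) ∷_) h′
  ...     | u′ , u′∈ , e = t , b , u′ , e , t∈ , b∈ , u′∈

  columns-length : ∀ L n {u} → u ∈ columns L n → length u ≡ n
  columns-length L zero (here refl) = refl
  columns-length L (suc n) u∈ with columns-∷⁻ L n u∈
  ... | _ , _ , _ , refl , _ , _ , u′∈ = cong suc (columns-length L n u′∈)

  columns-head : ∀ L n {t b u} → (t , b) ∷ u ∈ columns L n → t ∈ L × b ∈ L
  columns-head L zero (here ())
  columns-head L (suc n) u∈ with columns-∷⁻ L n u∈
  ... | _ , _ , _ , refl , t∈ , b∈ , _ = t∈ , b∈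

  ∑-allLabelings-suc : ∀ k m f → ∑ (allLabelings k (suc m)) f ≡
                       ∑ (upTo k) (λ j → ∑ (allLabelings k m) (λ l → f (j ∷ l)))
  ∑-allLabelings-suc k m f = begin
    ∑ (allLabelings k (suc m)) f                                     ≡⟨ ∑-concatMap _ (allLabelings k m) f ⟩
    ∑ (allLabelings k m) (λ l → ∑ (map (λ j → j ∷ l) (upTo k)) f)    ≡⟨ ∑-cong (allLabelings k m) (λ {l} _ → ∑-map (λ j → j ∷ l) (upTo k) f) ⟩
    ∑ (allLabelings k m) (λ l → ∑ (upTo k) (λ j → f (j ∷ l)))        ≡⟨ ∑-swap (allLabelings k m) (upTo k) _ ⟩
    ∑ (upTo k) (λ j → ∑ (allLabelings k m) (λ l → f (j ∷ l)))        ∎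
    where open ≡-Reasoning

  ∑-allLabelings-+ : ∀ k m n f → ∑ (allLabelings k (m + n)) f ≡
                     ∑ (allLabelings k m) (λ x → ∑ (allLabelings k n) (λ y → f (x ++ y)))
  ∑-allLabelings-+ k zero n f = sym (ℕₚ.+-identityʳ _)
  ∑-allLabelings-+ k (suc m) n f = begin
    ∑ (allLabelings k (suc m + n)) f
      ≡⟨ ∑-allLabelings-suc k (m + n) f ⟩
    ∑ (upTo k) (λ j → ∑ (allLabelings k (m + n)) (λ l → f (j ∷ l)))
      ≡⟨ ∑-cong (upTo k) (λ {j} _ → ∑-allLabelings-+ k m n (f ∘ (j ∷_))) ⟩
    ∑ (upTo k) (λ j → ∑ (allLabelings k m) (λ x → ∑ (allLabelings k n) (λ y → f (j ∷ x ++ y))))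
      ≡⟨ ∑-allLabelings-suc k m _ ⟨
    ∑ (allLabelings k (suc m)) (λ x → ∑ (allLabelings k n) (λ y → f (x ++ y)))
      ∎
    where open ≡-Reasoning

  -- Pairs of rows are regrouped into columns by exchanging sums, so no bijection between the two
  -- enumerations has to be built.
  ∑-columns : ∀ k n (h : List ℕ → List ℕ → ℕ) →
              ∑ (allLabelings k n) (λ x → ∑ (allLabelings k n) (λ y → h x y)) ≡
              ∑ (columns (upTo k) n) (λ u → h (map proj₁ u) (map proj₂ u))
  ∑-columns k zero h = ℕₚ.+-identityʳ _
  ∑-columns k (suc n) h = begin
    ∑ (allLabelings k (suc n)) (λ x → ∑ (allLabelings k (suc n)) (h x))
      ≡⟨ ∑-allLabelings-suc k n _ ⟩
    ∑ K (λ t → ∑ W (λ x → ∑ (allLabelings k (suc n)) (h (t ∷ x))))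
      ≡⟨ ∑-cong K (λ {t} _ → ∑-cong W λ {x} _ → ∑-allLabelings-suc k n (h (t ∷ x))) ⟩
    ∑ K (λ t → ∑ W (λ x → ∑ K (λ b → ∑ W (λ y → h (t ∷ x) (b ∷ y)))))
      ≡⟨ ∑-cong K (λ _ → ∑-swap W K _) ⟩
    ∑ K (λ t → ∑ K (λ b → ∑ W (λ x → ∑ W (λ y → h (t ∷ x) (b ∷ y)))))
      ≡⟨ ∑-cong K (λ {t} _ → ∑-cong K λ {b} _ → ∑-columns k n (λ x y → h (t ∷ x) (b ∷ y))) ⟩
    ∑ K (λ t → ∑ K (λ b → ∑ (columns K n) (λ u → h (t ∷ map proj₁ u) (b ∷ map proj₂ u))))
      ≡⟨ ∑-columns-suc K n _ ⟨
    ∑ (columns K (suc n)) (λ u → h (map proj₁ u) (map proj₂ u))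
      ∎
    where
    open ≡-Reasoning
    K = upTo k
    W = allLabelings k n

  -- Valid labelings with a given alphabet

  valid : List ℕ → Columns → Bool
  valid L u = allB (λ j → conn (indicator j u)) L

  allB-cong : ∀ {p q : A → Bool} xs → (∀ {x} → x ∈ xs → p x ≡ q x) → allB p xs ≡ allB q xs
  allB-cong [] h = refl
  allB-cong (x ∷ xs) h = cong₂ _∧_ (h (here refl)) (allB-cong xs (h ∘ there))

  validᵇ-flatten : ∀ k u → validᵇ k (length u) (flatten u) ≡ valid (upTo k) u
  validᵇ-flatten k u = allB-cong (upTo k) λ {j} _ → connectedᵇ-block j u

  -- Both are false on `[]`: the empty strip has no first column and belongs to neither state. The
  -- order `b ≡ᵇ t` in `diff` is the one in which `∑-∖` filters the second label.
  same diff : Columns → Bool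
  same [] = false
  same ((t , b) ∷ _) = t ≡ᵇ b
  diff [] = false
  diff ((t , b) ∷ _) = not (b ≡ᵇ t)

  -- Alphabets are arbitrary lists because a piece confined to the first column takes its label away
  -- from the remaining columns; this way no relabeling is ever needed.
  all-count same-count diff-count : List ℕ → ℕ → ℕ
  all-count L n = ∑ (columns L n) (λ u → χ (valid L u))
  same-count L n = ∑ (columns L n) (λ u → χ (same u) * χ (valid L u))
  diff-count L n = ∑ (columns L n) (λ u → χ (diff u) * χ (valid L u))

  labelings-count : ∀ k n → length (filter (λ l → validᵇ k n l ≟ true) (allLabelings k (2 * n))) ≡ all-count (upTo k) n
  labelings-count k n rewrite ℕₚ.+-identityʳ n = begin
    length (filter (λ l → validᵇ k n l ≟ true) (allLabelings k (n + n)))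
      ≡⟨ length-filter-χ (validᵇ k n) (allLabelings k (n + n)) ⟩
    ∑ (allLabelings k (n + n)) (χ ∘ validᵇ k n)
      ≡⟨ ∑-allLabelings-+ k n n _ ⟩
    ∑ (allLabelings k n) (λ x → ∑ (allLabelings k n) (λ y → χ (validᵇ k n (x ++ y))))
      ≡⟨ ∑-columns k n (λ x y → χ (validᵇ k n (x ++ y))) ⟩
    ∑ (columns (upTo k) n) (λ u → χ (validᵇ k n (flatten u)))
      ≡⟨ ∑-cong (columns (upTo k) n) (λ {u} u∈ → cong χ (trans
           (cong (λ m → validᵇ k m (flatten u)) (sym (columns-length (upTo k) n u∈)))
           (validᵇ-flatten k u))) ⟩
    all-count (upTo k) n ∎
    where open ≡-Reasoning

  ∑-+₄ : ∀ (xs : List A) (f g h k : A → ℕ) →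
         ∑ xs (λ x → f x + g x + h x + k x) ≡ ∑ xs f + ∑ xs g + ∑ xs h + ∑ xs k
  ∑-+₄ xs f g h k = trans (∑-+ xs (λ x → f x + g x + h x) k)
    (cong (_+ ∑ xs k) (trans (∑-+ xs (λ x → f x + g x) h) (cong (_+ ∑ xs h) (∑-+ xs f g))))

  conn-empty : ∀ xs → emptyᵇ xs ≡ true → conn xs ≡ false
  conn-empty [] _ = refl
  conn-empty ((false , false) ∷ xs) e = conn-empty xs e

  avoids : ℕ → Columns → Bool
  avoids t u = emptyᵇ (indicator t u)

  -- This is how a finished piece takes its label away: the condition that `t` does not occur again
  -- becomes a smaller alphabet for the remaining columns.
  ∑-avoids : ∀ L t n (f : Columns → ℕ) →
             ∑ (columns L n) (λ u → χ (avoids t u) * f u) ≡ ∑ (columns (L ∖ t) n) f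
  ∑-avoids L t zero f = cong (_+ 0) (ℕₚ.+-identityʳ (f []))
  ∑-avoids L t (suc n) f = begin
    ∑ (columns L (suc n)) (λ u → χ (avoids t u) * f u)
      ≡⟨ ∑-columns-suc L n _ ⟩
    ∑ L (λ a → ∑ L (λ b → ∑ (columns L n) (λ u → χ (avoids t ((a , b) ∷ u)) * f ((a , b) ∷ u))))
      ≡⟨ ∑-cong L (λ {a} _ → ∑-cong L λ {b} _ → trans (∑-cong (columns L n) λ {u} _ → factor a b u) (∑-*ˡ (columns L n) (χ≢ a) _)) ⟩
    ∑ L (λ a → ∑ L (λ b → χ≢ a * ∑ (columns L n) (λ u → χ≢ b * (χ (avoids t u) * f ((a , b) ∷ u)))))
      ≡⟨ ∑-cong L (λ {a} _ → ∑-*ˡ L (χ≢ a) _) ⟩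
    ∑ L (λ a → χ≢ a * ∑ L (λ b → ∑ (columns L n) (λ u → χ≢ b * (χ (avoids t u) * f ((a , b) ∷ u)))))
      ≡⟨ ∑-∖ L t _ ⟩
    ∑ (L ∖ t) (λ a → ∑ L (λ b → ∑ (columns L n) (λ u → χ≢ b * (χ (avoids t u) * f ((a , b) ∷ u)))))
      ≡⟨ ∑-cong (L ∖ t) (λ {a} _ → ∑-cong L λ {b} _ → trans (∑-*ˡ (columns L n) (χ≢ b) _)
           (cong (χ≢ b *_) (∑-avoids L t n (f ∘ ((a , b) ∷_))))) ⟩
    ∑ (L ∖ t) (λ a → ∑ L (λ b → χ≢ b * ∑ (columns (L ∖ t) n) (λ u → f ((a , b) ∷ u))))
      ≡⟨ ∑-cong (L ∖ t) (λ _ → ∑-∖ L t _) ⟩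
    ∑ (L ∖ t) (λ a → ∑ (L ∖ t) (λ b → ∑ (columns (L ∖ t) n) (λ u → f ((a , b) ∷ u))))
      ≡⟨ ∑-columns-suc (L ∖ t) n f ⟨
    ∑ (columns (L ∖ t) (suc n)) f
      ∎
    where
    open ≡-Reasoning
    χ≢ : ℕ → ℕ
    χ≢ a = χ (not (a ≡ᵇ t))
    factor : ∀ a b u → χ (avoids t ((a , b) ∷ u)) * f ((a , b) ∷ u) ≡
                       χ≢ a * (χ≢ b * (χ (avoids t u) * f ((a , b) ∷ u)))
    factor a b u rewrite χ-∧ (not (a ≡ᵇ t)) (not (b ≡ᵇ t) ∧ avoids t u) | χ-∧ (not (b ≡ᵇ t)) (avoids t u) =
      lem (χ≢ a) (χ≢ b) (χ (avoids t u)) _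
      where lem : ∀ x y z w → x * (y * z) * w ≡ x * (y * (z * w))
            lem = solve-∀

  valid-split : ∀ {L t} u → t ∈ L → valid L u ≡ conn (indicator t u) ∧ valid (L ∖ t) u
  valid-split {L} {t} u t∈ = bool-ext to from
    where
    to : valid L u ≡ true → conn (indicator t u) ∧ valid (L ∖ t) u ≡ true
    to h rewrite allB⁻ {p = λ j → conn (indicator j u)} {xs = L} h t∈ =
      allB⁺ (L ∖ t) λ x∈ → allB⁻ h (proj₁ (∈-∖⁻ L x∈))
    from : conn (indicator t u) ∧ valid (L ∖ t) u ≡ true → valid L u ≡ true
    from h with ∧-split {conn (indicator t u)} h
    ... | ht , hL = allB⁺ L λ {x} x∈ → case x x∈
      where
      case : ∀ x → x ∈ L → conn (indicator x u) ≡ true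
      case x x∈ with x ℕ.≟ t
      ... | yes refl = ht
      ... | no x≢t = allB⁻ hL (∈-∖⁺ x∈ x≢t)

  -- Labels absent from the first column have an empty column there, which `conn` skips.
  valid-tail : ∀ L {t b} u → (∀ {j} → j ∈ L → j ≢ t × j ≢ b) → valid L ((t , b) ∷ u) ≡ valid L u
  valid-tail L {t} {b} u h = allB-cong L λ {j} j∈ → lem j (h j∈)
    where
    lem : ∀ j → j ≢ t × j ≢ b → conn (indicator j ((t , b) ∷ u)) ≡ conn (indicator j u)
    lem j (j≢t , j≢b) rewrite ≡ᵇ-false (≢-sym j≢t) | ≡ᵇ-false (≢-sym j≢b) = refl

  topIs botIs : ℕ → Columns → Bool
  topIs t [] = false
  topIs t ((t′ , _) ∷ _) = t′ ≡ᵇ t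
  botIs b [] = false
  botIs b ((_ , b′) ∷ _) = b′ ≡ᵇ b

  -- Either the piece is confined to the first column, or it goes on to the right; with both cells
  -- in the piece, contact in either row is enough.
  conn-same : ∀ t u → χ (conn (indicator t ((t , t) ∷ u))) ≡
              χ (avoids t u) + χ (topIs t u ∨ botIs t u) * χ (conn (indicator t u))
  conn-same t u rewrite ≡ᵇ-refl t =
    trans (χ-join (avoids t u) (conn (indicator t u)) _ (conn-empty (indicator t u)))
          (cong (λ a → χ (avoids t u) + χ a * χ (conn (indicator t u))) (attach u))
    where
    attach : ∀ u → attached (true , true) (indicator t u) ≡ topIs t u ∨ botIs t u
    attach [] = refl
    attach (_ ∷ _) = refl

  conn-top : ∀ {t b} u → t ≢ b → χ (conn (indicator t ((t , b) ∷ u))) ≡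
             χ (avoids t u) + χ (topIs t u) * χ (conn (indicator t u))
  conn-top {t} {b} u t≢b rewrite ≡ᵇ-refl t | ≡ᵇ-false (≢-sym t≢b) =
    trans (χ-join (avoids t u) (conn (indicator t u)) _ (conn-empty (indicator t u)))
          (cong (λ a → χ (avoids t u) + χ a * χ (conn (indicator t u))) (attach u))
    where
    attach : ∀ u → attached (true , false) (indicator t u) ≡ topIs t u
    attach [] = refl
    attach ((t′ , _) ∷ _) = ∨-identityʳ (t′ ≡ᵇ t)

  conn-bot : ∀ {t b} u → t ≢ b → χ (conn (indicator b ((t , b) ∷ u))) ≡
             χ (avoids b u) + χ (botIs b u) * χ (conn (indicator b u))
  conn-bot {t} {b} u t≢b rewrite ≡ᵇ-refl b | ≡ᵇ-false t≢b =
    trans (χ-join (avoids b u) (conn (indicator b u)) _ (conn-empty (indicator b u)))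
          (cong (λ a → χ (avoids b u) + χ a * χ (conn (indicator b u))) (attach u))
    where
    attach : ∀ u → attached (false , true) (indicator b u) ≡ botIs b u
    attach [] = refl
    attach (_ ∷ _) = refl

  χ-valid-split : ∀ {L t} u → t ∈ L → χ (valid L u) ≡ χ (conn (indicator t u)) * χ (valid (L ∖ t) u)
  χ-valid-split {L} {t} u t∈ = trans (cong χ (valid-split u t∈)) (χ-∧ (conn (indicator t u)) _)

  valid-same : ∀ {L t} u → t ∈ L → χ (valid L ((t , t) ∷ u)) ≡
               χ (avoids t u) * χ (valid (L ∖ t) u) + χ (topIs t u ∨ botIs t u) * χ (valid L u)
  valid-same {L} {t} u t∈
    rewrite χ-valid-split {L} ((t , t) ∷ u) t∈ | χ-valid-split {L} u t∈ | conn-same t u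
          | valid-tail (L ∖ t) {t} {t} u (λ j∈ → proj₂ (∈-∖⁻ L j∈) , proj₂ (∈-∖⁻ L j∈))
    = lem (χ (avoids t u)) (χ (topIs t u ∨ botIs t u)) (χ (conn (indicator t u))) (χ (valid (L ∖ t) u))
    where
    lem : ∀ e a c w → (e + a * c) * w ≡ e * w + a * (c * w)
    lem = solve-∀

  ∖-comm : ∀ L t b u → valid (L ∖ t ∖ b) u ≡ valid (L ∖ b ∖ t) u
  ∖-comm L t b u = bool-ext (half t b) (half b t)
    where
    half : ∀ t b → valid (L ∖ t ∖ b) u ≡ true → valid (L ∖ b ∖ t) u ≡ true
    half t b h = allB⁺ (L ∖ b ∖ t) λ x∈ →
      let x∈Lb , x≢t = ∈-∖⁻ (L ∖ b) x∈ ; x∈L , x≢b = ∈-∖⁻ L x∈Lb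
      in allB⁻ h (∈-∖⁺ (∈-∖⁺ x∈L x≢t) x≢b)

  -- The product of two independent alternatives, since each of the two pieces ends in the first
  -- column or goes on. In order: both end, only `t` ends, only `b` ends, both go on.
  valid-diff : ∀ {L t b} u → t ∈ L → b ∈ L → t ≢ b → χ (valid L ((t , b) ∷ u)) ≡
               χ (avoids t u) * (χ (avoids b u) * χ (valid (L ∖ t ∖ b) u)) +
               χ (avoids t u) * (χ (botIs b u) * χ (valid (L ∖ t) u)) +
               χ (avoids b u) * (χ (topIs t u) * χ (valid (L ∖ b) u)) +
               χ (topIs t u) * (χ (botIs b u) * χ (valid L u))
  valid-diff {L} {t} {b} u t∈ b∈ t≢b
    rewrite χ-valid-split {L} ((t , b) ∷ u) t∈
          | χ-valid-split {L ∖ t} ((t , b) ∷ u) (∈-∖⁺ b∈ (≢-sym t≢b))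
          | χ-valid-split {L} u t∈
          | χ-valid-split {L ∖ t} u (∈-∖⁺ b∈ (≢-sym t≢b))
          | χ-valid-split {L ∖ b} u (∈-∖⁺ t∈ t≢b)
          -- The summand in which only `b` ends has lost `b` before `t`; the common factor is
          -- written with `t` removed first.
          | ∖-comm L b t u
          | conn-top u t≢b | conn-bot u t≢b
          | valid-tail (L ∖ t ∖ b) {t} {b} u
              (λ j∈ → let j∈Lt , j≢b = ∈-∖⁻ (L ∖ t) j∈ in proj₂ (∈-∖⁻ L j∈Lt) , j≢b)
    = lem (χ (avoids t u)) (χ (topIs t u)) (χ (conn (indicator t u)))
          (χ (avoids b u)) (χ (botIs b u)) (χ (conn (indicator b u))) (χ (valid (L ∖ t ∖ b) u))
    where
    lem : ∀ e p c e′ q d w → (e + p * c) * ((e′ + q * d) * w) ≡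
          e * (e′ * w) + e * (q * (d * w)) + e′ * (p * (c * w)) + p * (q * (c * (d * w)))
    lem = solve-∀

  -- Recursion over the first column

  -- The origin of the coefficients in sₖ + 2 dₖ: a column with equal labels can continue the one
  -- piece of the next column, or either of its two pieces.
  ∑-topOrBot : ∀ {L} n {u} → Unique L → u ∈ columns L n →
               ∑ L (λ t → χ (topIs t u ∨ botIs t u)) ≡ χ (same u) + 2 * χ (diff u)
  ∑-topOrBot {L} n {[]} uq u∈ = ∑-zero L
  ∑-topOrBot {L} n {(a , b) ∷ u} uq u∈ with columns-head L n u∈
  ... | a∈ , b∈ with a ℕ.≟ b
  ...   | yes refl rewrite ≡ᵇ-refl a = trans (∑-cong L λ {t} _ → lem (a ≡ᵇ t)) (∑-pick uq a∈ (λ _ → 1))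
    where lem : ∀ x → χ (x ∨ x) ≡ χ x * 1
          lem true = refl
          lem false = refl
  ...   | no a≢b rewrite ≡ᵇ-false a≢b | ≡ᵇ-false (≢-sym a≢b) = begin
    ∑ L (λ t → χ ((a ≡ᵇ t) ∨ (b ≡ᵇ t)))                     ≡⟨ ∑-cong L (λ {t} _ → lem t) ⟩
    ∑ L (λ t → χ (a ≡ᵇ t) * 1 + χ (b ≡ᵇ t) * 1)             ≡⟨ ∑-+ L _ _ ⟩
    ∑ L (λ t → χ (a ≡ᵇ t) * 1) + ∑ L (λ t → χ (b ≡ᵇ t) * 1) ≡⟨ cong₂ _+_ (∑-pick uq a∈ (λ _ → 1)) (∑-pick uq b∈ (λ _ → 1)) ⟩
    2                                                       ∎
    where
    open ≡-Reasoning
    lem : ∀ t → χ ((a ≡ᵇ t) ∨ (b ≡ᵇ t)) ≡ χ (a ≡ᵇ t) * 1 + χ (b ≡ᵇ t) * 1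
    lem t with a ≡ᵇ t in ea | b ≡ᵇ t in eb
    ... | true | true = contradiction (trans (≡ᵇ-sound ea) (sym (≡ᵇ-sound eb))) a≢b
    ... | true | false = refl
    ... | false | true = refl
    ... | false | false = refl

  same-count-suc : ∀ {L} n → Unique L → same-count L (suc n) ≡
                   ∑ L (λ t → all-count (L ∖ t) n) + (same-count L n + 2 * diff-count L n)
  same-count-suc {L} n uq = begin
    same-count L (suc n)
      ≡⟨ ∑-columns-suc L n _ ⟩
    ∑ L (λ t → ∑ L (λ b → ∑ C (λ u → χ (t ≡ᵇ b) * χ (valid L ((t , b) ∷ u)))))
      ≡⟨ ∑-cong L (λ {t} t∈ → trans (∑-cong L λ {b} _ → ∑-*ˡ C (χ (t ≡ᵇ b)) _) (∑-pick uq t∈ _)) ⟩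
    ∑ L (λ t → ∑ C (λ u → χ (valid L ((t , t) ∷ u))))
      ≡⟨ ∑-cong L (λ t∈ → trans (∑-cong C λ {u} _ → valid-same u t∈) (∑-+ C _ _)) ⟩
    ∑ L (λ t → ∑ C (λ u → χ (avoids t u) * χ (valid (L ∖ t) u)) + ∑ C (λ u → χ (topIs t u ∨ botIs t u) * χ (valid L u)))
      ≡⟨ ∑-+ L _ _ ⟩
    ∑ L (λ t → ∑ C (λ u → χ (avoids t u) * χ (valid (L ∖ t) u))) +
    ∑ L (λ t → ∑ C (λ u → χ (topIs t u ∨ botIs t u) * χ (valid L u)))
      ≡⟨ cong₂ _+_ (∑-cong L λ {t} _ → ∑-avoids L t n _) attach ⟩
    ∑ L (λ t → all-count (L ∖ t) n) + (same-count L n + 2 * diff-count L n)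
      ∎
    where
    open ≡-Reasoning
    C = columns L n
    lem : ∀ s d w → (s + 2 * d) * w ≡ s * w + 2 * (d * w)
    lem = solve-∀
    attach : ∑ L (λ t → ∑ C (λ u → χ (topIs t u ∨ botIs t u) * χ (valid L u))) ≡ same-count L n + 2 * diff-count L n
    attach = begin
      ∑ L (λ t → ∑ C (λ u → χ (topIs t u ∨ botIs t u) * χ (valid L u)))
        ≡⟨ ∑-swap L C _ ⟩
      ∑ C (λ u → ∑ L (λ t → χ (topIs t u ∨ botIs t u) * χ (valid L u)))
        ≡⟨ ∑-cong C (λ {u} u∈ → trans (∑-*ʳ L (χ (valid L u)) _)
             (trans (cong (_* χ (valid L u)) (∑-topOrBot n uq u∈)) (lem (χ (same u)) (χ (diff u)) (χ (valid L u))))) ⟩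
      ∑ C (λ u → χ (same u) * χ (valid L u) + 2 * (χ (diff u) * χ (valid L u)))
        ≡⟨ ∑-+ C _ _ ⟩
      same-count L n + ∑ C (λ u → 2 * (χ (diff u) * χ (valid L u)))
        ≡⟨ cong (same-count L n +_) (∑-*ˡ C 2 _) ⟩
      same-count L n + 2 * diff-count L n
        ∎

  same+diff : ∀ t b u → χ (same ((t , b) ∷ u)) + χ (diff ((t , b) ∷ u)) ≡ 1
  same+diff t b u rewrite ≡ᵇ-sym b t with t ≡ᵇ b
  ... | true = refl
  ... | false = refl

  -- The value is 1 for a nonempty `u`, whose first column has exactly one entry in the given row,
  -- and 0 for `[]`. For this reason `s + d` and not `v` appears in the recursion: the empty strip
  -- has a division, but nothing that a piece could continue into.
  ∑-is : ∀ {L} n {u} (is : ℕ → Columns → Bool) (entry : ℕ × ℕ → ℕ) →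
         (∀ t → is t [] ≡ false) → (∀ t c u → is t (c ∷ u) ≡ (entry c ≡ᵇ t)) →
         (∀ {c u} → c ∷ u ∈ columns L n → entry c ∈ L) →
         Unique L → u ∈ columns L n → ∑ L (λ t → χ (is t u)) ≡ χ (same u) + χ (diff u)
  ∑-is {L} n {[]} is _ nil _ _ uq u∈ = trans (∑-cong L λ {t} _ → cong χ (nil t)) (∑-zero L)
  ∑-is {L} n {(a , b) ∷ u} is entry _ cons mem uq u∈ = begin
    ∑ L (λ t → χ (is t ((a , b) ∷ u)))      ≡⟨ ∑-cong L (λ {t} _ → trans (cong χ (cons t (a , b) u)) (sym (ℕₚ.*-identityʳ _))) ⟩
    ∑ L (λ t → χ (entry (a , b) ≡ᵇ t) * 1)  ≡⟨ ∑-pick uq (mem u∈) (λ _ → 1) ⟩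
    1                                       ≡⟨ same+diff a b u ⟨
    χ (same ((a , b) ∷ u)) + χ (diff ((a , b) ∷ u)) ∎
    where open ≡-Reasoning

  ∑-topIs : ∀ {L} n {u} → Unique L → u ∈ columns L n → ∑ L (λ t → χ (topIs t u)) ≡ χ (same u) + χ (diff u)
  ∑-topIs {L} n = ∑-is n topIs proj₁ (λ _ → refl) (λ _ _ _ → refl) (λ c∈ → proj₁ (columns-head L n c∈))

  ∑-botIs : ∀ {L} n {u} → Unique L → u ∈ columns L n → ∑ L (λ t → χ (botIs t u)) ≡ χ (same u) + χ (diff u)
  ∑-botIs {L} n = ∑-is n botIs proj₂ (λ _ → refl) (λ _ _ _ → refl) (λ c∈ → proj₂ (columns-head L n c∈))

  ∑-is-valid : ∀ {L} n (is : ℕ → Columns → Bool) →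
               (∀ {u} → u ∈ columns L n → ∑ L (λ t → χ (is t u)) ≡ χ (same u) + χ (diff u)) →
               ∑ L (λ t → ∑ (columns L n) (λ u → χ (is t u) * χ (valid L u))) ≡ same-count L n + diff-count L n
  ∑-is-valid {L} n is h = begin
    ∑ L (λ t → ∑ C (λ u → χ (is t u) * χ (valid L u)))
      ≡⟨ ∑-swap L C _ ⟩
    ∑ C (λ u → ∑ L (λ t → χ (is t u) * χ (valid L u)))
      ≡⟨ ∑-cong C (λ {u} u∈ → trans (∑-*ʳ L (χ (valid L u)) _)
           (trans (cong (_* χ (valid L u)) (h u∈)) (ℕₚ.*-distribʳ-+ (χ (valid L u)) (χ (same u)) (χ (diff u))))) ⟩
    ∑ C (λ u → χ (same u) * χ (valid L u) + χ (diff u) * χ (valid L u))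
      ≡⟨ ∑-+ C _ _ ⟩
    same-count L n + diff-count L n
      ∎
    where
    open ≡-Reasoning
    C = columns L n

  -- Two pieces that both go on fix both labels of the next column, and their being different puts
  -- that column in the state `diff`: the term dₖ with coefficient 1.
  ∑-top-bot : ∀ {L} n {u} → Unique L → u ∈ columns L n →
              ∑ L (λ t → ∑ L (λ b → χ (not (b ≡ᵇ t)) * (χ (topIs t u) * χ (botIs b u)))) ≡ χ (diff u)
  ∑-top-bot {L} n {[]} uq u∈ = trans (∑-cong L λ {t} _ → trans (∑-cong L λ {b} _ → ℕₚ.*-zeroʳ (χ (not (b ≡ᵇ t)))) (∑-zero L)) (∑-zero L)
  ∑-top-bot {L} n {(t′ , b′) ∷ u} uq u∈ = begin
    ∑ L (λ t → ∑ L (λ b → χ (not (b ≡ᵇ t)) * (χ (t′ ≡ᵇ t) * χ (b′ ≡ᵇ b))))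
      ≡⟨ ∑-cong L (λ {t} _ → trans (∑-cong L λ {b} _ → lem (χ (not (b ≡ᵇ t))) (χ (t′ ≡ᵇ t)) (χ (b′ ≡ᵇ b)))
           (∑-pick uq (proj₂ (columns-head L n u∈)) _)) ⟩
    ∑ L (λ t → χ (t′ ≡ᵇ t) * χ (not (b′ ≡ᵇ t)))
      ≡⟨ ∑-pick uq (proj₁ (columns-head L n u∈)) _ ⟩
    χ (not (b′ ≡ᵇ t′))
      ∎
    where
    open ≡-Reasoning
    lem : ∀ x y z → x * (y * z) ≡ z * (y * x)
    lem = solve-∀

  diff-count-suc : ∀ {L} n → Unique L → diff-count L (suc n) ≡
                   ∑ L (λ t → ∑ (L ∖ t) (λ b → all-count (L ∖ t ∖ b) n)) +
                   ∑ L (λ t → same-count (L ∖ t) n + diff-count (L ∖ t) n) +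
                   ∑ L (λ t → same-count (L ∖ t) n + diff-count (L ∖ t) n) +
                   diff-count L n
  diff-count-suc {L} n uq = begin
    diff-count L (suc n)
      ≡⟨ ∑-columns-suc L n _ ⟩
    ∑ L (λ t → ∑ L (λ b → ∑ C (λ u → χ (not (b ≡ᵇ t)) * χ (valid L ((t , b) ∷ u)))))
      ≡⟨ ∑-cong L (λ {t} t∈ → ∑-cong L λ {b} b∈ → trans (∑-*ˡ C (χ (not (b ≡ᵇ t))) _) (expand t∈ b∈)) ⟩
    ∑ L (λ t → ∑ L (λ b → χ≢ t b * T₁ t b + χ≢ t b * T₂ t b + χ≢ t b * T₃ t b + χ≢ t b * T₄ t b))
      ≡⟨ ∑-cong L (λ {t} _ → ∑-+₄ L _ _ _ _) ⟩
    ∑ L (λ t → ∑ L (λ b → χ≢ t b * T₁ t b) + ∑ L (λ b → χ≢ t b * T₂ t b) + ∑ L (λ b → χ≢ t b * T₃ t b) + ∑ L (λ b → χ≢ t b * T₄ t b))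
      ≡⟨ ∑-+₄ L _ _ _ _ ⟩
    ∑ L (λ t → ∑ L (λ b → χ≢ t b * T₁ t b)) + ∑ L (λ t → ∑ L (λ b → χ≢ t b * T₂ t b)) +
    ∑ L (λ t → ∑ L (λ b → χ≢ t b * T₃ t b)) + ∑ L (λ t → ∑ L (λ b → χ≢ t b * T₄ t b))
      ≡⟨ cong₂ _+_ (cong₂ _+_ (cong₂ _+_ sum₁ sum₂) sum₃) sum₄ ⟩
    ∑ L (λ t → ∑ (L ∖ t) (λ b → all-count (L ∖ t ∖ b) n)) +
    ∑ L (λ t → same-count (L ∖ t) n + diff-count (L ∖ t) n) +
    ∑ L (λ t → same-count (L ∖ t) n + diff-count (L ∖ t) n) +
    diff-count L n
      ∎
    where
    open ≡-Reasoning
    C = columns L n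
    χ≢ T₁ T₂ T₃ T₄ : ℕ → ℕ → ℕ
    χ≢ t b = χ (not (b ≡ᵇ t))
    T₁ t b = ∑ C (λ u → χ (avoids t u) * (χ (avoids b u) * χ (valid (L ∖ t ∖ b) u)))
    T₂ t b = ∑ C (λ u → χ (avoids t u) * (χ (botIs b u) * χ (valid (L ∖ t) u)))
    T₃ t b = ∑ C (λ u → χ (avoids b u) * (χ (topIs t u) * χ (valid (L ∖ b) u)))
    T₄ t b = ∑ C (λ u → χ (topIs t u) * (χ (botIs b u) * χ (valid L u)))
    distrib : ∀ x a b c d → x * (a + b + c + d) ≡ x * a + x * b + x * c + x * d
    distrib = solve-∀
    expand : ∀ {t b} → t ∈ L → b ∈ L → χ≢ t b * ∑ C (λ u → χ (valid L ((t , b) ∷ u))) ≡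
             χ≢ t b * T₁ t b + χ≢ t b * T₂ t b + χ≢ t b * T₃ t b + χ≢ t b * T₄ t b
    expand {t} {b} t∈ b∈ with b ≡ᵇ t in e
    ... | true = refl
    ... | false = trans (cong (1 *_) (trans (∑-cong C λ {u} _ → valid-diff u t∈ b∈ t≢b)
                    (∑-+₄ C _ _ _ _)))
                    (distrib 1 (T₁ t b) (T₂ t b) (T₃ t b) (T₄ t b))
      where
      t≢b : t ≢ b
      t≢b refl = false⇒¬ e (≡ᵇ-refl t)
    sum₁ : ∑ L (λ t → ∑ L (λ b → χ≢ t b * T₁ t b)) ≡ ∑ L (λ t → ∑ (L ∖ t) (λ b → all-count (L ∖ t ∖ b) n))
    sum₁ = ∑-cong L λ {t} _ → trans (∑-∖ L t (T₁ t)) (∑-cong (L ∖ t) λ {b} _ →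
             trans (∑-avoids L t n _) (∑-avoids (L ∖ t) b n _))
    sum₂ : ∑ L (λ t → ∑ L (λ b → χ≢ t b * T₂ t b)) ≡ ∑ L (λ t → same-count (L ∖ t) n + diff-count (L ∖ t) n)
    sum₂ = ∑-cong L λ {t} _ → begin
      ∑ L (λ b → χ≢ t b * T₂ t b)
        ≡⟨ ∑-∖ L t (T₂ t) ⟩
      ∑ (L ∖ t) (T₂ t)
        ≡⟨ ∑-cong (L ∖ t) (λ _ → ∑-avoids L t n _) ⟩
      ∑ (L ∖ t) (λ b → ∑ (columns (L ∖ t) n) (λ u → χ (botIs b u) * χ (valid (L ∖ t) u)))
        ≡⟨ ∑-is-valid n botIs (∑-botIs n (Unique-∖ t uq)) ⟩
      same-count (L ∖ t) n + diff-count (L ∖ t) n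
        ∎
    sum₃ : ∑ L (λ t → ∑ L (λ b → χ≢ t b * T₃ t b)) ≡ ∑ L (λ t → same-count (L ∖ t) n + diff-count (L ∖ t) n)
    -- Here `b` is the label that is removed, so it has to be the outer variable.
    sum₃ = trans (∑-swap L L _) (∑-cong L λ {b} _ → begin
      ∑ L (λ t → χ≢ t b * T₃ t b)
        ≡⟨ ∑-cong L (λ {t} _ → cong (λ x → χ (not x) * T₃ t b) (≡ᵇ-sym b t)) ⟩
      ∑ L (λ t → χ≢ b t * T₃ t b)
        ≡⟨ ∑-∖ L b (λ t → T₃ t b) ⟩
      ∑ (L ∖ b) (λ t → T₃ t b)
        ≡⟨ ∑-cong (L ∖ b) (λ _ → ∑-avoids L b n _) ⟩
      ∑ (L ∖ b) (λ t → ∑ (columns (L ∖ b) n) (λ u → χ (topIs t u) * χ (valid (L ∖ b) u)))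
        ≡⟨ ∑-is-valid n topIs (∑-topIs n (Unique-∖ b uq)) ⟩
      same-count (L ∖ b) n + diff-count (L ∖ b) n
        ∎)
    regroup : ∀ x p q w → x * (p * (q * w)) ≡ x * (p * q) * w
    regroup = solve-∀
    sum₄ : ∑ L (λ t → ∑ L (λ b → χ≢ t b * T₄ t b)) ≡ diff-count L n
    sum₄ = begin
      ∑ L (λ t → ∑ L (λ b → χ≢ t b * T₄ t b))
        ≡⟨ ∑-cong L (λ {t} _ → ∑-cong L λ {b} _ → trans (sym (∑-*ˡ C (χ≢ t b) _))
             (∑-cong C λ {u} _ → regroup (χ≢ t b) (χ (topIs t u)) (χ (botIs b u)) (χ (valid L u)))) ⟩
      ∑ L (λ t → ∑ L (λ b → ∑ C (λ u → χ≢ t b * (χ (topIs t u) * χ (botIs b u)) * χ (valid L u))))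
        ≡⟨ ∑-cong L (λ _ → ∑-swap L C _) ⟩
      ∑ L (λ t → ∑ C (λ u → ∑ L (λ b → χ≢ t b * (χ (topIs t u) * χ (botIs b u)) * χ (valid L u))))
        ≡⟨ ∑-swap L C _ ⟩
      ∑ C (λ u → ∑ L (λ t → ∑ L (λ b → χ≢ t b * (χ (topIs t u) * χ (botIs b u)) * χ (valid L u))))
        ≡⟨ ∑-cong C (λ {u} u∈ → trans (∑-cong L λ _ → ∑-*ʳ L (χ (valid L u)) _) (trans (∑-*ʳ L (χ (valid L u)) _)
             (cong (_* χ (valid L u)) (∑-top-bot n uq u∈)))) ⟩
      diff-count L n
        ∎

  all-count-suc : ∀ L n → all-count L (suc n) ≡ same-count L (suc n) + diff-count L (suc n)
  all-count-suc L n = trans (∑-cong C λ u∈ → lem u∈) (∑-+ C _ _)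
    where
    C = columns L (suc n)
    lem : ∀ {u} → u ∈ C → χ (valid L u) ≡ χ (same u) * χ (valid L u) + χ (diff u) * χ (valid L u)
    lem {u} u∈ with columns-∷⁻ L n u∈
    ... | t , b , u′ , refl , _ = begin
      w                                                              ≡⟨ ℕₚ.*-identityˡ w ⟨
      1 * w                                                          ≡⟨ cong (_* w) (same+diff t b u′) ⟨
      (χ (same ((t , b) ∷ u′)) + χ (diff ((t , b) ∷ u′))) * w        ≡⟨ ℕₚ.*-distribʳ-+ w (χ (same ((t , b) ∷ u′))) _ ⟩
      χ (same ((t , b) ∷ u′)) * w + χ (diff ((t , b) ∷ u′)) * w      ∎
      where
      open ≡-Reasoning
      w = χ (valid L ((t , b) ∷ u′))

  -- From labelings to divisions: splitting off the factor `k !`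

  shiftᵏ : (ℕ → ℕ) → ℕ → ℕ
  shiftᵏ f zero = 0
  shiftᵏ f (suc k) = f k

  -- Divisions of the 2 × n strip into k pieces in which the two cells of the first column lie in
  -- the same piece (s n k), in different pieces (d n k), or all divisions (v n k).
  s d v : ℕ → ℕ → ℕ
  s zero k = 0
  s (suc n) k = shiftᵏ (v n) k + (s n k + 2 * d n k)
  d zero k = 0
  d (suc n) k = shiftᵏ (shiftᵏ (v n)) k + shiftᵏ (λ k → s n k + d n k) k + shiftᵏ (λ k → s n k + d n k) k + d n k
  v zero zero = 1
  v zero (suc k) = 0
  v (suc n) k = s (suc n) k + d (suc n) k

  -- Each of the k choices of `t` leaves an alphabet of k - 1 labels, and k · (k - 1)! = k!. For the
  -- empty alphabet the sum is empty, in agreement with `shiftᵏ f 0`.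
  ∑-remove : ∀ (F : List ℕ → ℕ) (f : ℕ → ℕ) → (∀ M → Unique M → F M ≡ length M ! * f (length M)) →
             ∀ L → Unique L → ∑ L (λ t → F (L ∖ t)) ≡ length L ! * shiftᵏ f (length L)
  ∑-remove F f h [] uq = refl
  ∑-remove F f h L@(x ∷ L′) uq = begin
    ∑ L (λ t → F (L ∖ t))                    ≡⟨ ∑-cong L (λ {t} t∈ → trans (h (L ∖ t) (Unique-∖ t uq))
                                                  (cong (λ k → k ! * f k) (sym (ℕₚ.suc-injective (length-∖ uq t∈))))) ⟩
    ∑ L (λ _ → length L′ ! * f (length L′))   ≡⟨ ∑-const L _ ⟩
    length L * (length L′ ! * f (length L′))  ≡⟨ ℕₚ.*-assoc (length L) (length L′ !) (f (length L′)) ⟨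
    length L ! * f (length L′)                ∎
    where open ≡-Reasoning

  -- The counts depend on the alphabet only through its size. The induction needs the statement for
  -- all alphabets, because the recursion passes to `L ∖ t` and `L ∖ t ∖ b`.
  same-count-formula : ∀ n L → Unique L → same-count L n ≡ length L ! * s n (length L)
  diff-count-formula : ∀ n L → Unique L → diff-count L n ≡ length L ! * d n (length L)
  all-count-formula : ∀ n L → Unique L → all-count L n ≡ length L ! * v n (length L)

  same-count-formula zero L uq = sym (ℕₚ.*-zeroʳ (length L !))
  same-count-formula (suc n) L uq = begin
    same-count L (suc n)
      ≡⟨ same-count-suc n uq ⟩
    ∑ L (λ t → all-count (L ∖ t) n) + (same-count L n + 2 * diff-count L n)
      ≡⟨ cong₂ _+_ (∑-remove (λ M → all-count M n) (v n) (all-count-formula n) L uq)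
           (cong₂ (λ x y → x + 2 * y) (same-count-formula n L uq) (diff-count-formula n L uq)) ⟩
    length L ! * shiftᵏ (v n) (length L) + (length L ! * s n (length L) + 2 * (length L ! * d n (length L)))
      ≡⟨ lem (length L !) _ _ _ ⟩
    length L ! * s (suc n) (length L)
      ∎
    where
    open ≡-Reasoning
    lem : ∀ k a b c → k * a + (k * b + 2 * (k * c)) ≡ k * (a + (b + 2 * c))
    lem = solve-∀

  diff-count-formula zero L uq = sym (ℕₚ.*-zeroʳ (length L !))
  diff-count-formula (suc n) L uq = begin
    diff-count L (suc n)
      ≡⟨ diff-count-suc n uq ⟩
    ∑ L (λ t → ∑ (L ∖ t) (λ b → all-count (L ∖ t ∖ b) n)) + Σsd + Σsd + diff-count L n
      ≡⟨ cong₂ _+_ (cong₂ _+_ (cong₂ _+_ all-part sd-part) sd-part) (diff-count-formula n L uq) ⟩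
    k! * shiftᵏ (shiftᵏ (v n)) (length L) + k! * shiftᵏ sd (length L) + k! * shiftᵏ sd (length L) + k! * d n (length L)
      ≡⟨ lem k! _ _ _ ⟩
    k! * d (suc n) (length L)
      ∎
    where
    open ≡-Reasoning
    k! = length L !
    Σsd = ∑ L (λ t → same-count (L ∖ t) n + diff-count (L ∖ t) n)
    sd : ℕ → ℕ
    sd k = s n k + d n k
    all-part : ∑ L (λ t → ∑ (L ∖ t) (λ b → all-count (L ∖ t ∖ b) n)) ≡ k! * shiftᵏ (shiftᵏ (v n)) (length L)
    -- Two pieces end at once: the inner removal serves as the hypothesis of the outer one.
    all-part = ∑-remove (λ M → ∑ M (λ b → all-count (M ∖ b) n)) (shiftᵏ (v n))
                 (∑-remove (λ M → all-count M n) (v n) (all-count-formula n)) L uq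
    sd-part : Σsd ≡ k! * shiftᵏ sd (length L)
    sd-part = ∑-remove (λ M → same-count M n + diff-count M n) sd
                (λ M uqM → trans (cong₂ _+_ (same-count-formula n M uqM) (diff-count-formula n M uqM))
                             (sym (ℕₚ.*-distribˡ-+ (length M !) (s n (length M)) (d n (length M))))) L uq
    lem : ∀ k a b c → k * a + k * b + k * b + k * c ≡ k * (a + b + b + c)
    lem = solve-∀

  -- The empty strip is valid for the empty alphabet only, since a label would need a nonempty
  -- block.
  all-count-formula zero [] uq = refl
  all-count-formula zero L@(_ ∷ _) uq = sym (ℕₚ.*-zeroʳ (length L !))
  all-count-formula (suc n) L uq = trans (all-count-suc L n)
    (trans (cong₂ _+_ (same-count-formula (suc n) L uq) (diff-count-formula (suc n) L uq))
           (sym (ℕₚ.*-distribˡ-+ (length L !) (s (suc n) (length L)) (d (suc n) (length L)))))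

  -- The number of valid labelings is an exact multiple of `k !`, so the truncating division in `r`
  -- loses nothing.
  r≡v : ∀ k n → r k n ≡ v n k
  r≡v k n = trans (cong (λ m → ℕ._/_ m (k !) {{k ℕₚ.!≢0}}) count) (m*n/n≡m (v n k) (k !) {{k ℕₚ.!≢0}})
    where
    open ≡-Reasoning
    count : length (filter (λ l → validᵇ k n l ≟ true) (allLabelings k (2 * n))) ≡ v n k * k !
    count = begin
      length (filter (λ l → validᵇ k n l ≟ true) (allLabelings k (2 * n))) ≡⟨ labelings-count k n ⟩
      all-count (upTo k) n                             ≡⟨ all-count-formula n (upTo k) (upTo⁺ k) ⟩
      length (upTo k) ! * v n (length (upTo k))        ≡⟨ cong (λ j → j ! * v n j) (length-upTo k) ⟩
      k ! * v n k                                      ≡⟨ ℕₚ.*-comm (k !) (v n k) ⟩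
      v n k * k !                                      ∎

  -- Numbers of divisions and of pieces

  -- Value and derivative at 1 of the generating polynomial of `f`, of degree below `K`. The field
  -- `vanishes` allows `K` to be raised, so that terms shifted by different amounts can be added
  -- over one range.
  record Moments (f : ℕ → ℕ) (K zeroth first : ℕ) : Set where
    field
      vanishes : ∀ k → K ≤ k → f k ≡ 0
      zeroth≡  : ∑ (upTo K) f ≡ zeroth
      first≡   : ∑ (upTo K) (λ k → k * f k) ≡ first
  open Moments

  ∑-upTo-suc : ∀ K (f : ℕ → ℕ) → ∑ (upTo (suc K)) f ≡ f 0 + ∑ (upTo K) (f ∘ suc)
  ∑-upTo-suc K f = cong (f 0 +_) (trans (cong (λ xs → ∑ xs f) (sym (map-upTo suc K))) (∑-map suc (upTo K) f))

  ∑-upTo-last : ∀ K (f : ℕ → ℕ) → ∑ (upTo (suc K)) f ≡ ∑ (upTo K) f + f K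
  ∑-upTo-last K f = begin
    ∑ (upTo (suc K)) f            ≡⟨ cong (λ xs → ∑ xs f) (upTo-∷ʳ K) ⟨
    ∑ (upTo K ∷ʳ K) f             ≡⟨ ∑-++ (upTo K) (K ∷ []) f ⟩
    ∑ (upTo K) f + (f K + 0)      ≡⟨ cong (∑ (upTo K) f +_) (ℕₚ.+-identityʳ (f K)) ⟩
    ∑ (upTo K) f + f K            ∎
    where open ≡-Reasoning

  moments-extend : ∀ {f K a b} → Moments f K a b → Moments f (suc K) a b
  moments-extend {f} {K} M .vanishes k lt = vanishes M k (ℕₚ.<⇒≤ lt)
  moments-extend {f} {K} {a} M .zeroth≡ = begin
    ∑ (upTo (suc K)) f   ≡⟨ ∑-upTo-last K f ⟩
    ∑ (upTo K) f + f K   ≡⟨ cong₂ _+_ (zeroth≡ M) (vanishes M K ℕₚ.≤-refl) ⟩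
    a + 0                ≡⟨ ℕₚ.+-identityʳ a ⟩
    a                    ∎
    where open ≡-Reasoning
  moments-extend {f} {K} {_} {b} M .first≡ = begin
    ∑ (upTo (suc K)) (λ k → k * f k)           ≡⟨ ∑-upTo-last K _ ⟩
    ∑ (upTo K) (λ k → k * f k) + K * f K       ≡⟨ cong₂ (λ x y → x + K * y) (first≡ M) (vanishes M K ℕₚ.≤-refl) ⟩
    b + K * 0                                  ≡⟨ cong (b +_) (ℕₚ.*-zeroʳ K) ⟩
    b + 0                                      ≡⟨ ℕₚ.+-identityʳ b ⟩
    b                                          ∎
    where open ≡-Reasoning

  -- The shift multiplies the generating polynomial F by x, and (x F)′ = x F′ + F at x = 1.
  moments-shift : ∀ {f K a b} → Moments f K a b → Moments (shiftᵏ f) (suc K) a (b + a)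
  moments-shift M .vanishes (suc k) (s≤s le) = vanishes M k le
  moments-shift {f} {K} M .zeroth≡ = trans (∑-upTo-suc K (shiftᵏ f)) (zeroth≡ M)
  moments-shift {f} {K} {a} {b} M .first≡ = begin
    ∑ (upTo (suc K)) (λ k → k * shiftᵏ f k)              ≡⟨ ∑-upTo-suc K (λ k → k * shiftᵏ f k) ⟩
    ∑ (upTo K) (λ k → f k + k * f k)                     ≡⟨ ∑-+ (upTo K) f _ ⟩
    ∑ (upTo K) f + ∑ (upTo K) (λ k → k * f k)            ≡⟨ cong₂ _+_ (zeroth≡ M) (first≡ M) ⟩
    a + b                                                ≡⟨ ℕₚ.+-comm a b ⟩
    b + a                                                ∎
    where open ≡-Reasoning

  moments-+ : ∀ {f g K a b a′ b′} → Moments f K a b → Moments g K a′ b′ →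
              Moments (λ k → f k + g k) K (a + a′) (b + b′)
  moments-+ M M′ .vanishes k le = cong₂ _+_ (vanishes M k le) (vanishes M′ k le)
  moments-+ {K = K} M M′ .zeroth≡ = trans (∑-+ (upTo K) _ _) (cong₂ _+_ (zeroth≡ M) (zeroth≡ M′))
  moments-+ {f} {g} {K} M M′ .first≡ =
    trans (∑-cong (upTo K) λ {k} _ → ℕₚ.*-distribˡ-+ k (f k) (g k))
      (trans (∑-+ (upTo K) _ _) (cong₂ _+_ (first≡ M) (first≡ M′)))

  moments-* : ∀ {f K a b} c → Moments f K a b → Moments (λ k → c * f k) K (c * a) (c * b)
  moments-* c M .vanishes k le = trans (cong (c *_) (vanishes M k le)) (ℕₚ.*-zeroʳ c)
  moments-* {K = K} c M .zeroth≡ = trans (∑-*ˡ (upTo K) c _) (cong (c *_) (zeroth≡ M))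
  moments-* {f} {K} c M .first≡ =
    trans (∑-cong (upTo K) λ {k} _ → lem k c (f k)) (trans (∑-*ˡ (upTo K) c _) (cong (c *_) (first≡ M)))
    where lem : ∀ k c x → k * (c * x) ≡ c * (k * x)
          lem = solve-∀

  -- S, D, PS, PD at m are Σₖ s n k, Σₖ d n k, Σₖ k · s n k and Σₖ k · d n k for n = m + 1.
  S D PS PD : ℕ → ℕ
  S zero = 1
  S (suc m) = 2 * S m + 3 * D m
  D zero = 1
  D (suc m) = 3 * S m + 4 * D m
  PS zero = 1
  PS (suc m) = 2 * PS m + 3 * PD m + S m + D m
  PD zero = 2
  PD (suc m) = 3 * PS m + 4 * PD m + 4 * S m + 4 * D m

  -- One column adds at most two pieces, whence the bound `2 + K`, to which the other terms are
  -- extended.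
  moments-step-s : ∀ {n K a b a′ b′ a″ b″} →
    Moments (s n) K a b → Moments (d n) K a′ b′ → Moments (v n) K a″ b″ →
    Moments (s (suc n)) (2 + K) (a″ + (a + 2 * a′)) (b″ + a″ + (b + 2 * b′))
  moments-step-s Ms Md Mv =
    moments-+ (moments-extend (moments-shift Mv))
      (moments-extend (moments-extend (moments-+ Ms (moments-* 2 Md))))

  moments-step-d : ∀ {n K a b a′ b′ a″ b″} →
    Moments (s n) K a b → Moments (d n) K a′ b′ → Moments (v n) K a″ b″ →
    Moments (d (suc n)) (2 + K) (a″ + (a + a′) + (a + a′) + a′)
            (b″ + a″ + a″ + (b + b′ + (a + a′)) + (b + b′ + (a + a′)) + b′)
  moments-step-d Ms Md Mv =
    moments-+ (moments-+ (moments-+ (moments-shift (moments-shift Mv)) Msd) Msd)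
      (moments-extend (moments-extend Md))
    where Msd = moments-extend (moments-shift (moments-+ Ms Md))

  moments-cast : ∀ {f K K′ a a′ b b′} → K ≡ K′ → a ≡ a′ → b ≡ b′ → Moments f K a b → Moments f K′ a′ b′
  moments-cast refl refl refl M = M

  moments-s : ∀ m → Moments (s (suc m)) (suc (2 * suc m)) (S m) (PS m)
  moments-d : ∀ m → Moments (d (suc m)) (suc (2 * suc m)) (D m) (PD m)
  moments-v : ∀ m → Moments (v (suc m)) (suc (2 * suc m)) (S m + D m) (PS m + PD m)
  moments-v m = moments-+ (moments-s m) (moments-d m)

  moments-zero : Moments (λ _ → 0) 1 0 0
  moments-zero .vanishes _ _ = refl
  moments-zero .zeroth≡ = refl
  moments-zero .first≡ = refl

  moments-v₀ : Moments (v 0) 1 1 0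
  moments-v₀ .vanishes (suc k) _ = refl
  moments-v₀ .zeroth≡ = refl
  moments-v₀ .first≡ = refl

  two-more : ∀ m → 2 + suc (2 * suc m) ≡ suc (2 * suc (suc m))
  two-more = solve-∀

  moments-s zero = moments-step-s {0} moments-zero moments-zero moments-v₀
  moments-s (suc m) = moments-cast (two-more m) (zeroth (S m) (D m)) (first (S m) (D m) (PS m) (PD m))
                        (moments-step-s {suc m} (moments-s m) (moments-d m) (moments-v m))
    where
    zeroth : ∀ a b → a + b + (a + 2 * b) ≡ 2 * a + 3 * b
    zeroth = solve-∀
    first : ∀ a b p q → p + q + (a + b) + (p + 2 * q) ≡ 2 * p + 3 * q + a + b
    first = solve-∀
  moments-d zero = moments-step-d {0} moments-zero moments-zero moments-v₀
  moments-d (suc m) = moments-cast (two-more m) (zeroth (S m) (D m)) (first (S m) (D m) (PS m) (PD m))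
                        (moments-step-d {suc m} (moments-s m) (moments-d m) (moments-v m))
    where
    zeroth : ∀ a b → a + b + (a + b) + (a + b) + b ≡ 3 * a + 4 * b
    zeroth = solve-∀
    first : ∀ a b p q → p + q + (a + b) + (a + b) + (p + q + (a + b)) + (p + q + (a + b)) + q ≡
            3 * p + 4 * q + 4 * a + 4 * b
    first = solve-∀

  sum-map : ∀ {A : Set} (f : A → ℕ) xs → sum (map f xs) ≡ ∑ xs f
  sum-map f [] = refl
  sum-map f (x ∷ xs) = cong (f x +_) (sum-map f xs)

  totalDivisions-formula : ∀ m → totalDivisions (suc m) ≡ S m + D m
  totalDivisions-formula m = begin
    totalDivisions n                          ≡⟨ sum-map (λ k → r k n) (upTo (suc (2 * n))) ⟩
    ∑ (upTo (suc (2 * n))) (λ k → r k n)      ≡⟨ ∑-cong (upTo (suc (2 * n))) (λ {k} _ → r≡v k n) ⟩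
    ∑ (upTo (suc (2 * n))) (v n)              ≡⟨ zeroth≡ (moments-v m) ⟩
    S m + D m                                 ∎
    where
    open ≡-Reasoning
    n = suc m

  totalPieces-formula : ∀ m → totalPieces (suc m) ≡ PS m + PD m
  totalPieces-formula m = begin
    totalPieces n                             ≡⟨ sum-map (λ k → k * r k n) (upTo (suc (2 * n))) ⟩
    ∑ (upTo (suc (2 * n))) (λ k → k * r k n)  ≡⟨ ∑-cong (upTo (suc (2 * n))) (λ {k} _ → cong (k *_) (r≡v k n)) ⟩
    ∑ (upTo (suc (2 * n))) (λ k → k * v n k)  ≡⟨ first≡ (moments-v m) ⟩
    PS m + PD m                               ∎
    where
    open ≡-Reasoning
    n = suc m

  -- With M = (2 3; 3 4) and F = (1 1; 4 4), the recursion is p′ = M p + F w for w = (S, D), itself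
  -- a solution of w′ = M w. Because of this resonance the ansatz is 20 p = (n A + B) w with A
  -- commuting with M, which requires A M + B M - M B = 20 F. The solution matching the first column
  -- is A = (34 -12; -12 26), B = (-21 19; 23 3); negative entries stand on the other side to stay
  -- in `ℕ`.
  closed-PS : ∀ m → 20 * PS m + (12 * suc m * D m + 21 * S m) ≡ 34 * suc m * S m + 19 * D m
  closed-PD : ∀ m → 20 * PD m + 12 * suc m * S m ≡ 26 * suc m * D m + 23 * S m + 3 * D m
  closed-PS zero = refl
  closed-PS (suc m) = begin
    20 * PS (suc m) + (12 * suc (suc m) * D (suc m) + 21 * S (suc m))
      ≡⟨ split m (S m) (D m) (PS m) (PD m) ⟩
    2 * (20 * PS m + (12 * suc m * D m + 21 * S m)) + 3 * (20 * PD m + 12 * suc m * S m) + (24 * m * D m + 56 * S m + 155 * D m)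
      ≡⟨ cong₂ (λ x y → 2 * x + 3 * y + (24 * m * D m + 56 * S m + 155 * D m)) (closed-PS m) (closed-PD m) ⟩
    2 * (34 * suc m * S m + 19 * D m) + 3 * (26 * suc m * D m + 23 * S m + 3 * D m) + (24 * m * D m + 56 * S m + 155 * D m)
      ≡⟨ join m (S m) (D m) ⟩
    34 * suc (suc m) * S (suc m) + 19 * D (suc m)
      ∎
    where
    open ≡-Reasoning
    split : ∀ m a b p q → 20 * (2 * p + 3 * q + a + b) + (12 * suc (suc m) * (3 * a + 4 * b) + 21 * (2 * a + 3 * b)) ≡
            2 * (20 * p + (12 * suc m * b + 21 * a)) + 3 * (20 * q + 12 * suc m * a) + (24 * m * b + 56 * a + 155 * b)
    split = solve-∀
    join : ∀ m a b → 2 * (34 * suc m * a + 19 * b) + 3 * (26 * suc m * b + 23 * a + 3 * b) + (24 * m * b + 56 * a + 155 * b) ≡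
           34 * suc (suc m) * (2 * a + 3 * b) + 19 * (3 * a + 4 * b)
    join = solve-∀
  closed-PD zero = refl
  -- The induction hypotheses use up `48 * m * S m`, twice what the left side contains; the other
  -- half is added on both sides.
  closed-PD (suc m) = ℕₚ.+-cancelʳ-≡ (24 * m * S m) _ _ (begin
    20 * PD (suc m) + 12 * suc (suc m) * S (suc m) + 24 * m * S m
      ≡⟨ split m (S m) (D m) (PS m) (PD m) ⟩
    3 * (20 * PS m + (12 * suc m * D m + 21 * S m)) + 4 * (20 * PD m + 12 * suc m * S m) + (17 * S m + 116 * D m)
      ≡⟨ cong₂ (λ x y → 3 * x + 4 * y + (17 * S m + 116 * D m)) (closed-PS m) (closed-PD m) ⟩
    3 * (34 * suc m * S m + 19 * D m) + 4 * (26 * suc m * D m + 23 * S m + 3 * D m) + (17 * S m + 116 * D m)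
      ≡⟨ join m (S m) (D m) ⟩
    26 * suc (suc m) * D (suc m) + 23 * S (suc m) + 3 * D (suc m) + 24 * m * S m
      ∎)
    where
    open ≡-Reasoning
    split : ∀ m a b p q → 20 * (3 * p + 4 * q + 4 * a + 4 * b) + 12 * suc (suc m) * (2 * a + 3 * b) + 24 * m * a ≡
            3 * (20 * p + (12 * suc m * b + 21 * a)) + 4 * (20 * q + 12 * suc m * a) + (17 * a + 116 * b)
    split = solve-∀
    join : ∀ m a b → 3 * (34 * suc m * a + 19 * b) + 4 * (26 * suc m * b + 23 * a + 3 * b) + (17 * a + 116 * b) ≡
           26 * suc (suc m) * (3 * a + 4 * b) + 23 * (2 * a + 3 * b) + 3 * (3 * a + 4 * b) + 24 * m * a
    join = solve-∀

  closed-pieces : ∀ m → 20 * (PS m + PD m) ≡ suc m * (22 * S m + 14 * D m) + (2 * S m + 22 * D m)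
  closed-pieces m = ℕₚ.+-cancelʳ-≡ (12 * suc m * D m + 21 * S m + 12 * suc m * S m) _ _ (begin
    20 * (PS m + PD m) + (12 * suc m * D m + 21 * S m + 12 * suc m * S m)
      ≡⟨ split m (S m) (D m) (PS m) (PD m) ⟩
    20 * PS m + (12 * suc m * D m + 21 * S m) + (20 * PD m + 12 * suc m * S m)
      ≡⟨ cong₂ _+_ (closed-PS m) (closed-PD m) ⟩
    34 * suc m * S m + 19 * D m + (26 * suc m * D m + 23 * S m + 3 * D m)
      ≡⟨ join m (S m) (D m) ⟩
    suc m * (22 * S m + 14 * D m) + (2 * S m + 22 * D m) + (12 * suc m * D m + 21 * S m + 12 * suc m * S m)
      ∎)
    where
    open ≡-Reasoning
    split : ∀ m a b p q → 20 * (p + q) + (12 * suc m * b + 21 * a + 12 * suc m * a) ≡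
            20 * p + (12 * suc m * b + 21 * a) + (20 * q + 12 * suc m * a)
    split = solve-∀
    join : ∀ m a b → 34 * suc m * a + 19 * b + (26 * suc m * b + 23 * a + 3 * b) ≡
           suc m * (22 * a + 14 * b) + (2 * a + 22 * b) + (12 * suc m * b + 21 * a + 12 * suc m * a)
    join = solve-∀

  -- The norm equation a² - 10 b² = ± 1 of the powers of 3 + √10, where a = S + 2 D and 2 b = S + D.
  pellˡ pellʳ : ℕ → ℕ
  pellˡ m = 3 * (D m * D m)
  pellʳ m = 2 * (S m * D m) + 3 * (S m * S m)

  -- The step matrix has determinant -1 and multiplies the form `pellˡ - pellʳ` by it; written with
  -- sums, a change of sign needs no subtraction.
  pell-conserved : ∀ m → pellˡ (suc m) + pellˡ m ≡ pellʳ (suc m) + pellʳ m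
  pell-conserved m = lem (S m) (D m)
    where
    lem : ∀ a b → 3 * ((3 * a + 4 * b) * (3 * a + 4 * b)) + 3 * (b * b) ≡
          2 * ((2 * a + 3 * b) * (3 * a + 4 * b)) + 3 * ((2 * a + 3 * b) * (2 * a + 3 * b)) + (2 * (a * b) + 3 * (a * a))
    lem = solve-∀

  pell : ∀ m → pellˡ m ≡ pellʳ m + 2 ⊎ pellˡ m + 2 ≡ pellʳ m
  pell zero = inj₂ refl
  pell (suc m) with pell m
  ... | inj₁ e = inj₂ (ℕₚ.+-cancelʳ-≡ (pellʳ m) _ _ (begin
    pellˡ (suc m) + 2 + pellʳ m   ≡⟨ ℕₚ.+-assoc (pellˡ (suc m)) 2 (pellʳ m) ⟩
    pellˡ (suc m) + (2 + pellʳ m) ≡⟨ cong (pellˡ (suc m) +_) (trans (ℕₚ.+-comm 2 (pellʳ m)) (sym e)) ⟩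
    pellˡ (suc m) + pellˡ m       ≡⟨ pell-conserved m ⟩
    pellʳ (suc m) + pellʳ m       ∎))
    where open ≡-Reasoning
  ... | inj₂ e = inj₁ (ℕₚ.+-cancelʳ-≡ (pellˡ m) _ _ (begin
    pellˡ (suc m) + pellˡ m       ≡⟨ pell-conserved m ⟩
    pellʳ (suc m) + pellʳ m       ≡⟨ cong (pellʳ (suc m) +_) (trans (sym e) (ℕₚ.+-comm (pellˡ m) 2)) ⟩
    pellʳ (suc m) + (2 + pellˡ m) ≡⟨ ℕₚ.+-assoc (pellʳ (suc m)) 2 (pellˡ m) ⟨
    pellʳ (suc m) + 2 + pellˡ m   ∎))
    where open ≡-Reasoning

  -- Gives δ ≥ 1/2 and thereby g ≥ 3/5.
  S≤D : ∀ m → S m ≤ D m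
  S≤D zero = ℕₚ.≤-refl
  S≤D (suc m) = ℕₚ.+-mono-≤ (ℕₚ.m≤n+m (2 * S m) (S m)) (ℕₚ.m≤n+m (3 * D m) (D m))

  -- The growth is exponential, but a linear bound already makes 1 / (S + D)² at most 1/n.
  m<S+D : ∀ m → suc m ≤ S m + D m
  m<S+D zero = s≤s z≤n
  m<S+D (suc m) = ℕₚ.≤-trans (s≤s (m<S+D m)) (ℕₚ.≤-trans (ℕₚ.+-monoˡ-≤ (S m + D m) (ℕₚ.≤-trans (s≤s z≤n) (m<S+D m)))
    (subst (S m + D m + (S m + D m) ≤_) (lem (S m) (D m)) (ℕₚ.m≤m+n _ (3 * S m + 5 * D m))))
    where lem : ∀ a b → a + b + (a + b) + (3 * a + 5 * b) ≡ 2 * a + 3 * b + (3 * a + 4 * b)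
          lem = solve-∀

open import Data.Integer as ℤ using (+_)
import Data.Integer.Properties as ℤₚ
open Counting using (S; D; PS; PD; pellˡ; pellʳ; pell; S≤D; m<S+D; closed-pieces; totalDivisions-formula; totalPieces-formula)
open import Data.Rational using (_<_; _+_; _-_; _*_; _/_)
open +-*-Solver using (solve; con; _:+_; _:*_; _:=_; _:-_)

-- Rational estimates

ι : ℕ → ℚ
ι n = fromℤ (+ n)

ι-+ : ∀ m n → ι (m ℕ.+ n) ≡ ι m + ι n
ι-+ m n = toℚᵘ-injective (ℚᵘₚ.≃-trans (ℚᵘ.*≡* (cong (ℤ._* + 1) (sym (cong₂ ℤ._+_ (ℤₚ.*-identityʳ (+ m)) (ℤₚ.*-identityʳ (+ n))))))
                            (ℚᵘₚ.≃-sym (toℚᵘ-homo-+ (ι m) (ι n))))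

ι-* : ∀ m n → ι (m ℕ.* n) ≡ ι m * ι n
ι-* m n = toℚᵘ-injective (ℚᵘₚ.≃-trans (ℚᵘ.*≡* (cong (ℤ._* + 1) (ℤₚ.pos-* m n)))
                            (ℚᵘₚ.≃-sym (toℚᵘ-homo-* (ι m) (ι n))))

ι-mono-≤ : ∀ {m n} → m ≤ n → ι m ℚ.≤ ι n
ι-mono-≤ m≤n = ℚ.*≤* (ℤₚ.*-monoʳ-≤-nonNeg (+ 1) (ℤ.+≤+ m≤n))

ratio-* : ∀ a d .{{_ : ℕ.NonZero d}} → ratio a d * ι d ≡ ι a
ratio-* a d@(suc d-1) = toℚᵘ-injective (ℚᵘₚ.≃-trans (toℚᵘ-homo-* (ratio a d) (ι d))
  (ℚᵘₚ.≃-trans (ℚᵘₚ.*-congʳ {x = toℚᵘ (ι d)} (toℚᵘ-fromℚᵘ (ℚᵘ.mkℚᵘ (+ a) d-1)))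
    (ℚᵘ.*≡* (trans (ℤₚ.*-identityʳ (+ a ℤ.* + d)) (cong (λ k → + a ℤ.* + k) (sym (ℕₚ.*-identityʳ d)))))))

ratio-pos : ∀ d .{{_ : ℕ.NonZero d}} → 0ℚ < ratio 1 d
ratio-pos (suc d-1) = ℚₚ.positive⁻¹ (+ 1 / suc d-1) {{ℚₚ.normalize-pos 1 (suc d-1)}}

*-mono-≤ˡ : ∀ {r p q} → 0ℚ ℚ.≤ r → p ℚ.≤ q → r * p ℚ.≤ r * q
*-mono-≤ˡ {r} h = ℚₚ.*-monoˡ-≤-nonNeg r {{nonNegative h}}

*-mono-≤ʳ : ∀ {r p q} → 0ℚ ℚ.≤ r → p ℚ.≤ q → p * r ℚ.≤ q * r
*-mono-≤ʳ {r} h = ℚₚ.*-monoʳ-≤-nonNeg r {{nonNegative h}}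

-- Here 3/5 is the lower bound of g and 8 η that of the margin t; 19/5 is the excess of 24/5 over 1.
scale-< : ∀ {η} → 0ℚ < η → η < (+ 3 / 5) * (ι 8 * η)
scale-< {η} 0<η = subst₂ _<_ (ℚₚ.+-identityʳ η) (solve 1 (λ η → η :+ con (+ 19 / 5) :* η := con (+ 3 / 5) :* (con (ι 8) :* η)) refl η)
  (ℚₚ.+-monoʳ-< η (subst (_< (+ 19 / 5) * η) (ℚₚ.*-zeroʳ (+ 19 / 5)) (ℚₚ.*-monoʳ-<-pos (+ 19 / 5) 0<η)))

8η≤t⇒0≤t : ∀ {η t} → 0ℚ < η → ι 8 * η ℚ.≤ t → 0ℚ ℚ.≤ t
8η≤t⇒0≤t {η} 0<η le = ℚₚ.≤-trans (subst (ℚ._≤ ι 8 * η) (ℚₚ.*-zeroʳ (ι 8)) (*-mono-≤ˡ {ι 8} (ι-mono-≤ {0} z≤n) (ℚₚ.<⇒≤ 0<η))) le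

η<gt : ∀ {g t η} → 0ℚ < η → (+ 3 / 5) ℚ.≤ g → ι 8 * η ℚ.≤ t → η < g * t
η<gt {g} {t} {η} 0<η g≥ t≥ = begin-strict
  η                       <⟨ scale-< 0<η ⟩
  (+ 3 / 5) * (ι 8 * η)   ≤⟨ *-mono-≤ˡ {+ 3 / 5} (ℚₚ.<⇒≤ (ℚₚ.positive⁻¹ (+ 3 / 5))) t≥ ⟩
  (+ 3 / 5) * t           ≤⟨ *-mono-≤ʳ (8η≤t⇒0≤t 0<η t≥) g≥ ⟩
  g * t                   ∎
  where open ℚₚ.≤-Reasoning

-- Already the part g t of (g + t)² - g² exceeds the error η.
√<-above : ∀ {g t η} → 0ℚ < η → (+ 3 / 5) ℚ.≤ g → ι 8 * η ℚ.≤ t →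
           (+ 2 / 5) ℚ.≤ g * g + η → (+ 2 / 5) √< (g + t)
√<-above {g} {t} {η} 0<η g≥ t≥ le = 0<g+t , (begin-strict
  + 2 / 5                     ≤⟨ le ⟩
  g * g + η                   <⟨ ℚₚ.+-monoʳ-< (g * g) (η<gt 0<η g≥ t≥) ⟩
  g * g + g * t               ≡⟨ ℚₚ.+-identityʳ _ ⟨
  g * g + g * t + 0ℚ          ≤⟨ ℚₚ.+-monoʳ-≤ (g * g + g * t) (subst (ℚ._≤ t * (g + t)) (ℚₚ.*-zeroʳ t) (*-mono-≤ˡ 0≤t (ℚₚ.<⇒≤ 0<g+t))) ⟩
  g * g + g * t + t * (g + t) ≡⟨ solve 2 (λ g t → g :* g :+ g :* t :+ t :* (g :+ t) := (g :+ t) :* (g :+ t)) refl g t ⟩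
  (g + t) * (g + t)           ∎)
  where
  open ℚₚ.≤-Reasoning
  0≤t = 8η≤t⇒0≤t 0<η t≥
  0<g+t : 0ℚ < g + t
  0<g+t = ℚₚ.+-mono-<-≤ (ℚₚ.<-≤-trans (ℚₚ.positive⁻¹ (+ 3 / 5)) g≥) 0≤t

-- If g - t is not negative, then (g - t)² ≤ (g - t) g = g² - g t, and g t exceeds the error η.
<√-below : ∀ {g t η} → 0ℚ < η → (+ 3 / 5) ℚ.≤ g → ι 8 * η ℚ.≤ t →
           g * g ℚ.≤ (+ 2 / 5) + η → (g - t) <√ (+ 2 / 5)
<√-below {g} {t} {η} 0<η g≥ t≥ le with (g - t) ℚₚ.<? 0ℚ
... | yes neg = inj₁ neg
... | no ¬neg = inj₂ (begin-strict
  (g - t) * (g - t)     ≤⟨ *-mono-≤ˡ (ℚₚ.≮⇒≥ ¬neg) g-t≤g ⟩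
  (g - t) * g           ≡⟨ solve 2 (λ g t → (g :- t) :* g := g :* g :- g :* t) refl g t ⟩
  g * g - g * t         <⟨ ℚₚ.+-mono-≤-< le (ℚₚ.neg-antimono-< (η<gt 0<η g≥ t≥)) ⟩
  (+ 2 / 5) + η - η     ≡⟨ solve 2 (λ c η → c :+ η :- η := c) refl (+ 2 / 5) η ⟩
  + 2 / 5               ∎)
  where
  open ℚₚ.≤-Reasoning
  g-t≤g : g - t ℚ.≤ g
  g-t≤g = subst (g - t ℚ.≤_) (ℚₚ.+-identityʳ g) (ℚₚ.+-monoʳ-≤ g (ℚₚ.neg-antimono-≤ (8η≤t⇒0≤t 0<η t≥)))

-- g = 2/5 (1 + δ) tends to √(2/5), the error being controlled by ρ.
g² : ∀ δ → (+ 2 / 5) * (1ℚ + δ) * ((+ 2 / 5) * (1ℚ + δ)) ≡ (+ 1 / 25) * (ι 4 + (ι 4 * (δ * δ) + ι 8 * δ))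
g² = solve 1 (λ δ → con (+ 2 / 5) :* (con 1ℚ :+ δ) :* (con (+ 2 / 5) :* (con 1ℚ :+ δ)) :=
                    con (+ 1 / 25) :* (con (ι 4) :+ (con (ι 4) :* (δ :* δ) :+ con (ι 8) :* δ))) refl

g²-approx : ∀ {δ ρ} → (ι 4 * (δ * δ) + ι 8 * δ ≡ ι 6 + ι 4 * ρ) ⊎ (ι 4 * (δ * δ) + ι 8 * δ + ι 4 * ρ ≡ ι 6) →
            let g = (+ 2 / 5) * (1ℚ + δ) ; e = (+ 4 / 25) * ρ in
            (g * g ≡ (+ 2 / 5) + e) ⊎ (g * g + e ≡ + 2 / 5)
g²-approx {δ} {ρ} (inj₁ h) = inj₁ (trans (g² δ) (trans (cong (λ y → (+ 1 / 25) * (ι 4 + y)) h)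
  (solve 1 (λ ρ → con (+ 1 / 25) :* (con (ι 4) :+ (con (ι 6) :+ con (ι 4) :* ρ)) :=
                  con (+ 2 / 5) :+ con (+ 4 / 25) :* ρ) refl ρ)))
g²-approx {δ} {ρ} (inj₂ h) = inj₂ (trans (cong (_+ (+ 4 / 25) * ρ) (g² δ)) (trans
  (solve 2 (λ y ρ → con (+ 1 / 25) :* (con (ι 4) :+ y) :+ con (+ 4 / 25) :* ρ :=
                    con (+ 1 / 25) :* (con (ι 4) :+ (y :+ con (ι 4) :* ρ))) refl (ι 4 * (δ * δ) + ι 8 * δ) ρ)
  (cong (λ y → (+ 1 / 25) * (ι 4 + y)) h)))

-- Used with η = 1/n, δ = D/T, ρ = 1/T² and x = Eₙ/n, where T = S + D. Solving the linear equation
-- gives 3/2 - x = g - `shift`. Of the 10 η available in ε, at most 2 η go to `shift`, and 8 η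
-- remain as the margin for comparing squares.
bracket : ∀ {ε η δ ρ x} → 0ℚ < η → ι 10 * η ℚ.≤ ε → (+ 1 / 2) ℚ.≤ δ → δ ℚ.≤ 1ℚ → 0ℚ ℚ.≤ ρ → ρ ℚ.≤ η →
          ι 10 * x + ι 4 * δ ≡ ι 11 + η + ι 10 * (δ * η) →
          (ι 4 * (δ * δ) + ι 8 * δ ≡ ι 6 + ι 4 * ρ) ⊎ (ι 4 * (δ * δ) + ι 8 * δ + ι 4 * ρ ≡ ι 6) →
          ((+ 2 / 5) √< ((+ 3 / 2 + ε) - x)) × (((+ 3 / 2 - ε) - x) <√ (+ 2 / 5))
bracket {ε} {η} {δ} {ρ} {x} 0<η ε≥ δ≥ δ≤ 0≤ρ ρ≤η eq approx =
  subst ((+ 2 / 5) √<_) (sym upper≡) (√<-above 0<η g≥ upper≥ lower-g²) ,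
  subst (_<√ (+ 2 / 5)) (sym lower≡) (<√-below 0<η g≥ lower≥ upper-g²)
  where
  open ℚₚ.≤-Reasoning
  g = (+ 2 / 5) * (1ℚ + δ)
  shift = (+ 1 / 10 + δ) * η
  0≤η = ℚₚ.<⇒≤ 0<η
  g≥ : (+ 3 / 5) ℚ.≤ g
  g≥ = *-mono-≤ˡ {+ 2 / 5} {1ℚ + + 1 / 2} (ℚₚ.<⇒≤ (ℚₚ.positive⁻¹ (+ 2 / 5))) (ℚₚ.+-monoʳ-≤ 1ℚ δ≥)
  x≡ : x ≡ (+ 1 / 10) * (ι 11 + η + ι 10 * (δ * η)) - (+ 2 / 5) * δ
  x≡ = trans (solve 2 (λ x δ → x := con (+ 1 / 10) :* (con (ι 10) :* x :+ con (ι 4) :* δ) :- con (+ 2 / 5) :* δ) refl x δ)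
             (cong (λ y → (+ 1 / 10) * y - (+ 2 / 5) * δ) eq)
  upper≡ : (+ 3 / 2 + ε) - x ≡ g + (ε - shift)
  upper≡ = trans (cong (λ y → (+ 3 / 2 + ε) - y) x≡) (solve 3 (λ ε δ η →
    con (+ 3 / 2) :+ ε :- (con (+ 1 / 10) :* (con (ι 11) :+ η :+ con (ι 10) :* (δ :* η)) :- con (+ 2 / 5) :* δ) :=
    con (+ 2 / 5) :* (con 1ℚ :+ δ) :+ (ε :- (con (+ 1 / 10) :+ δ) :* η)) refl ε δ η)
  lower≡ : (+ 3 / 2 - ε) - x ≡ g - (ε + shift)
  lower≡ = trans (cong (λ y → (+ 3 / 2 - ε) - y) x≡) (solve 3 (λ ε δ η →
    con (+ 3 / 2) :- ε :- (con (+ 1 / 10) :* (con (ι 11) :+ η :+ con (ι 10) :* (δ :* η)) :- con (+ 2 / 5) :* δ) :=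
    con (+ 2 / 5) :* (con 1ℚ :+ δ) :- (ε :+ (con (+ 1 / 10) :+ δ) :* η)) refl ε δ η)
  shift≤ : shift ℚ.≤ ι 2 * η
  shift≤ = *-mono-≤ʳ 0≤η (ℚₚ.≤-trans {+ 1 / 10 + δ} {+ 1 / 10 + 1ℚ} {ι 2} (ℚₚ.+-monoʳ-≤ (+ 1 / 10) δ≤) (ℚ.*≤* (ℤ.+≤+ (ℕₚ.m≤m+n 11 9))))
  0≤shift : 0ℚ ℚ.≤ shift
  0≤shift = subst (ℚ._≤ shift) (ℚₚ.*-zeroˡ η) (*-mono-≤ʳ 0≤η (ℚₚ.≤-trans {0ℚ} {+ 1 / 10 + + 1 / 2} (ℚₚ.<⇒≤ (ℚₚ.positive⁻¹ _)) (ℚₚ.+-monoʳ-≤ (+ 1 / 10) δ≥)))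
  upper≥ : ι 8 * η ℚ.≤ ε - shift
  upper≥ = begin
    ι 8 * η             ≡⟨ solve 1 (λ η → con (ι 8) :* η := con (ι 10) :* η :- con (ι 2) :* η) refl η ⟩
    ι 10 * η - ι 2 * η  ≤⟨ ℚₚ.+-mono-≤ ε≥ (ℚₚ.neg-antimono-≤ shift≤) ⟩
    ε - shift           ∎
  lower≥ : ι 8 * η ℚ.≤ ε + shift
  lower≥ = begin
    ι 8 * η        ≤⟨ *-mono-≤ʳ 0≤η (ι-mono-≤ (ℕₚ.m≤m+n 8 2)) ⟩
    ι 10 * η       ≤⟨ ε≥ ⟩
    ε              ≡⟨ ℚₚ.+-identityʳ ε ⟨
    ε + 0ℚ         ≤⟨ ℚₚ.+-monoʳ-≤ ε 0≤shift ⟩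
    ε + shift      ∎
  error≤ : (+ 4 / 25) * ρ ℚ.≤ η
  error≤ = begin
    (+ 4 / 25) * ρ ≤⟨ *-mono-≤ʳ {ρ} {+ 4 / 25} {1ℚ} 0≤ρ (ℚ.*≤* (ℤ.+≤+ (ℕₚ.m≤m+n 4 21))) ⟩
    1ℚ * ρ         ≡⟨ ℚₚ.*-identityˡ ρ ⟩
    ρ              ≤⟨ ρ≤η ⟩
    η              ∎
  0≤error : 0ℚ ℚ.≤ (+ 4 / 25) * ρ
  0≤error = subst (ℚ._≤ (+ 4 / 25) * ρ) (ℚₚ.*-zeroʳ (+ 4 / 25)) (*-mono-≤ˡ {+ 4 / 25} (ℚₚ.<⇒≤ (ℚₚ.positive⁻¹ (+ 4 / 25))) 0≤ρ)
  e = (+ 4 / 25) * ρ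
  square = g²-approx {δ} {ρ} approx
  lower-g² : (+ 2 / 5) ℚ.≤ g * g + η
  lower-g² with square
  ... | inj₁ h = begin
    + 2 / 5              ≡⟨ ℚₚ.+-identityʳ (+ 2 / 5) ⟨
    (+ 2 / 5) + 0ℚ       ≤⟨ ℚₚ.+-monoʳ-≤ (+ 2 / 5) 0≤error ⟩
    (+ 2 / 5) + e        ≡⟨ h ⟨
    g * g                ≡⟨ ℚₚ.+-identityʳ (g * g) ⟨
    g * g + 0ℚ           ≤⟨ ℚₚ.+-monoʳ-≤ (g * g) 0≤η ⟩
    g * g + η            ∎
  ... | inj₂ h = begin
    + 2 / 5              ≡⟨ h ⟨
    g * g + e            ≤⟨ ℚₚ.+-monoʳ-≤ (g * g) error≤ ⟩
    g * g + η            ∎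
  upper-g² : g * g ℚ.≤ (+ 2 / 5) + η
  upper-g² with square
  ... | inj₁ h = begin
    g * g                ≡⟨ h ⟩
    (+ 2 / 5) + e        ≤⟨ ℚₚ.+-monoʳ-≤ (+ 2 / 5) error≤ ⟩
    (+ 2 / 5) + η        ∎
  ... | inj₂ h = begin
    g * g                ≡⟨ ℚₚ.+-identityʳ (g * g) ⟨
    g * g + 0ℚ           ≤⟨ ℚₚ.+-mono-≤ (ℚₚ.≤-refl {g * g}) 0≤error ⟩
    g * g + e            ≡⟨ h ⟩
    + 2 / 5              ≡⟨ ℚₚ.+-identityʳ (+ 2 / 5) ⟨
    (+ 2 / 5) + 0ℚ       ≤⟨ ℚₚ.+-monoʳ-≤ (+ 2 / 5) 0≤η ⟩
    (+ 2 / 5) + η        ∎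

-- Dividing the integer identities by `n` and `T`

T : ℕ → ℕ
T m = S m ℕ.+ D m

T-nonZero : ∀ m → ℕ.NonZero (T m)
T-nonZero m = ℕ.>-nonZero (ℕₚ.≤-trans (s≤s z≤n) (m<S+D m))

-- `S` is eliminated in favour of `T`, so that division by n T leaves only Eₙ/n, 1/n and δ = D/T.
pieces-ℕ : ∀ m → 10 ℕ.* (PS m ℕ.+ PD m) ℕ.+ 4 ℕ.* (suc m ℕ.* D m) ≡
                 11 ℕ.* (suc m ℕ.* T m) ℕ.+ T m ℕ.+ 10 ℕ.* D m
pieces-ℕ m = ℕₚ.*-cancelˡ-≡ _ _ 2 (trans (left (PS m ℕ.+ PD m) (suc m ℕ.* D m))
  (trans (cong (ℕ._+ 8 ℕ.* (suc m ℕ.* D m)) (closed-pieces m)) (right m (S m) (D m))))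
  where
  left : ∀ p x → 2 ℕ.* (10 ℕ.* p ℕ.+ 4 ℕ.* x) ≡ 20 ℕ.* p ℕ.+ 8 ℕ.* x
  left = ℕ-Solver.solve-∀
  right : ∀ m a b → suc m ℕ.* (22 ℕ.* a ℕ.+ 14 ℕ.* b) ℕ.+ (2 ℕ.* a ℕ.+ 22 ℕ.* b) ℕ.+ 8 ℕ.* (suc m ℕ.* b) ≡
          2 ℕ.* (11 ℕ.* (suc m ℕ.* (a ℕ.+ b)) ℕ.+ (a ℕ.+ b) ℕ.+ 10 ℕ.* b)
  right = ℕ-Solver.solve-∀

ι-pieces : ∀ m → ι 10 * ι (PS m ℕ.+ PD m) + ι 4 * (ι (suc m) * ι (D m)) ≡
                 ι 11 * (ι (suc m) * ι (T m)) + ι (T m) + ι 10 * ι (D m)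
ι-pieces m = trans (sym left) (trans (cong ι (pieces-ℕ m)) right)
  where
  P = PS m ℕ.+ PD m
  left : ι (10 ℕ.* P ℕ.+ 4 ℕ.* (suc m ℕ.* D m)) ≡ ι 10 * ι P + ι 4 * (ι (suc m) * ι (D m))
  left = trans (ι-+ (10 ℕ.* P) (4 ℕ.* (suc m ℕ.* D m))) (cong₂ _+_ (ι-* 10 P)
           (trans (ι-* 4 (suc m ℕ.* D m)) (cong (ι 4 *_) (ι-* (suc m) (D m)))))
  right : ι (11 ℕ.* (suc m ℕ.* T m) ℕ.+ T m ℕ.+ 10 ℕ.* D m) ≡
          ι 11 * (ι (suc m) * ι (T m)) + ι (T m) + ι 10 * ι (D m)
  right = trans (ι-+ (11 ℕ.* (suc m ℕ.* T m) ℕ.+ T m) (10 ℕ.* D m)) (cong₂ _+_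
            (trans (ι-+ (11 ℕ.* (suc m ℕ.* T m)) (T m)) (cong (_+ ι (T m))
              (trans (ι-* 11 (suc m ℕ.* T m)) (cong (ι 11 *_) (ι-* (suc m) (T m))))))
            (ι-* 10 (D m)))

-- The equation is multiplied by η τ. The relations N η = 1 and T τ = 1 are not ring identities, so
-- factors 1 are inserted and exchanged between the ring steps.
divide-pieces : ∀ {x P N T D η τ} → N * η ≡ 1ℚ → T * τ ≡ 1ℚ → x * (N * T) ≡ P →
                ι 10 * P + ι 4 * (N * D) ≡ ι 11 * (N * T) + T + ι 10 * D →
                ι 10 * x + ι 4 * (D * τ) ≡ ι 11 + η + ι 10 * (D * τ * η)
divide-pieces {x} {P} {N} {T} {D} {η} {τ} Nη Tτ xNT eq = begin
  ι 10 * x + ι 4 * (D * τ)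
    ≡⟨ solve 3 (λ x D τ → con (ι 10) :* x :+ con (ι 4) :* (D :* τ) :=
         con (ι 10) :* (x :* (con 1ℚ :* con 1ℚ)) :+ con (ι 4) :* (con 1ℚ :* (D :* τ))) refl x D τ ⟩
  ι 10 * (x * (1ℚ * 1ℚ)) + ι 4 * (1ℚ * (D * τ))
    ≡⟨ cong₂ (λ a b → ι 10 * (x * (a * b)) + ι 4 * (a * (D * τ))) Nη Tτ ⟨
  ι 10 * (x * (N * η * (T * τ))) + ι 4 * (N * η * (D * τ))
    ≡⟨ solve 6 (λ x N T D η τ → con (ι 10) :* (x :* (N :* η :* (T :* τ))) :+ con (ι 4) :* (N :* η :* (D :* τ)) :=
         (con (ι 10) :* (x :* (N :* T)) :+ con (ι 4) :* (N :* D)) :* (η :* τ)) refl x N T D η τ ⟩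
  (ι 10 * (x * (N * T)) + ι 4 * (N * D)) * (η * τ)
    ≡⟨ cong (λ a → (ι 10 * a + ι 4 * (N * D)) * (η * τ)) xNT ⟩
  (ι 10 * P + ι 4 * (N * D)) * (η * τ)
    ≡⟨ cong (_* (η * τ)) eq ⟩
  (ι 11 * (N * T) + T + ι 10 * D) * (η * τ)
    ≡⟨ solve 5 (λ N T D η τ → (con (ι 11) :* (N :* T) :+ T :+ con (ι 10) :* D) :* (η :* τ) :=
         con (ι 11) :* (N :* η :* (T :* τ)) :+ T :* τ :* η :+ con (ι 10) :* (D :* τ :* η)) refl N T D η τ ⟩
  ι 11 * (N * η * (T * τ)) + T * τ * η + ι 10 * (D * τ * η)
    ≡⟨ cong₂ (λ a b → ι 11 * (a * b) + b * η + ι 10 * (D * τ * η)) Nη Tτ ⟩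
  ι 11 * (1ℚ * 1ℚ) + 1ℚ * η + ι 10 * (D * τ * η)
    ≡⟨ solve 3 (λ D η τ → con (ι 11) :* (con 1ℚ :* con 1ℚ) :+ con 1ℚ :* η :+ con (ι 10) :* (D :* τ :* η) :=
         con (ι 11) :+ η :+ con (ι 10) :* (D :* τ :* η)) refl D η τ ⟩
  ι 11 + η + ι 10 * (D * τ * η)
    ∎
  where open ≡-Reasoning

En/n-* : ∀ m → En/n (suc m) * (ι (suc m) * ι (T m)) ≡ ι (PS m ℕ.+ PD m)
En/n-* m = begin
  En/n n * (ι n * ι (T m))          ≡⟨ cong₂ _*_ (cong₂ ratio (totalPieces-formula m) (cong (n ℕ.*_) (totalDivisions-formula m))) (sym (ι-* n (T m))) ⟩
  ratio P (n ℕ.* T m) * ι (n ℕ.* T m) ≡⟨ ratio-* P (n ℕ.* T m) {{ℕₚ.m*n≢0 n (T m) {{_}} {{T-nonZero m}}}} ⟩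
  ι P                               ∎
  where
  open ≡-Reasoning
  n = suc m
  P = PS m ℕ.+ PD m

-- Twice the Pell relation with S = T - D, that is 4 (D + T)² = 10 T² ± 4; divided by 25 T² it says
-- g² = 2/5 ± 4 / (25 T²).
pell-T : ∀ m → (4 ℕ.* (D m ℕ.* D m) ℕ.+ 8 ℕ.* (D m ℕ.* T m) ≡ 6 ℕ.* (T m ℕ.* T m) ℕ.+ 4)
             ⊎ (4 ℕ.* (D m ℕ.* D m) ℕ.+ 8 ℕ.* (D m ℕ.* T m) ℕ.+ 4 ≡ 6 ℕ.* (T m ℕ.* T m))
pell-T m with pell m
... | inj₁ e = inj₁ (trans (left (S m) (D m)) (trans (cong (λ x → 2 ℕ.* x ℕ.+ rest) e) (right (S m) (D m))))
  where
  rest = 6 ℕ.* (D m ℕ.* D m) ℕ.+ 8 ℕ.* (S m ℕ.* D m)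
  left : ∀ a b → 4 ℕ.* (b ℕ.* b) ℕ.+ 8 ℕ.* (b ℕ.* (a ℕ.+ b)) ≡
         2 ℕ.* (3 ℕ.* (b ℕ.* b)) ℕ.+ (6 ℕ.* (b ℕ.* b) ℕ.+ 8 ℕ.* (a ℕ.* b))
  left = ℕ-Solver.solve-∀
  right : ∀ a b → 2 ℕ.* (2 ℕ.* (a ℕ.* b) ℕ.+ 3 ℕ.* (a ℕ.* a) ℕ.+ 2) ℕ.+ (6 ℕ.* (b ℕ.* b) ℕ.+ 8 ℕ.* (a ℕ.* b)) ≡
          6 ℕ.* ((a ℕ.+ b) ℕ.* (a ℕ.+ b)) ℕ.+ 4
  right = ℕ-Solver.solve-∀
... | inj₂ e = inj₂ (trans (left (S m) (D m)) (trans (cong (λ x → 2 ℕ.* x ℕ.+ rest) e) (right (S m) (D m))))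
  where
  rest = 6 ℕ.* (D m ℕ.* D m) ℕ.+ 8 ℕ.* (S m ℕ.* D m)
  left : ∀ a b → 4 ℕ.* (b ℕ.* b) ℕ.+ 8 ℕ.* (b ℕ.* (a ℕ.+ b)) ℕ.+ 4 ≡
         2 ℕ.* (3 ℕ.* (b ℕ.* b) ℕ.+ 2) ℕ.+ (6 ℕ.* (b ℕ.* b) ℕ.+ 8 ℕ.* (a ℕ.* b))
  left = ℕ-Solver.solve-∀
  right : ∀ a b → 2 ℕ.* (2 ℕ.* (a ℕ.* b) ℕ.+ 3 ℕ.* (a ℕ.* a)) ℕ.+ (6 ℕ.* (b ℕ.* b) ℕ.+ 8 ℕ.* (a ℕ.* b)) ≡
          6 ℕ.* ((a ℕ.+ b) ℕ.* (a ℕ.+ b))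
  right = ℕ-Solver.solve-∀

divide-pellˡ : ∀ {T D τ} → T * τ ≡ 1ℚ →
               (ι 4 * (D * D) + ι 8 * (D * T)) * (τ * τ) ≡ ι 4 * (D * τ * (D * τ)) + ι 8 * (D * τ)
divide-pellˡ {T} {D} {τ} Tτ = begin
  (ι 4 * (D * D) + ι 8 * (D * T)) * (τ * τ)
    ≡⟨ solve 3 (λ T D τ → (con (ι 4) :* (D :* D) :+ con (ι 8) :* (D :* T)) :* (τ :* τ) :=
         con (ι 4) :* (D :* τ :* (D :* τ)) :+ con (ι 8) :* (D :* τ) :* (T :* τ)) refl T D τ ⟩
  ι 4 * (D * τ * (D * τ)) + ι 8 * (D * τ) * (T * τ)
    ≡⟨ cong (λ a → ι 4 * (D * τ * (D * τ)) + a) (trans (cong (λ b → ι 8 * (D * τ) * b) Tτ) (ℚₚ.*-identityʳ (ι 8 * (D * τ)))) ⟩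
  ι 4 * (D * τ * (D * τ)) + ι 8 * (D * τ)
    ∎
  where open ≡-Reasoning

divide-pellʳ : ∀ {T τ} → T * τ ≡ 1ℚ → ι 6 * (T * T) * (τ * τ) ≡ ι 6
divide-pellʳ {T} {τ} Tτ = begin
  ι 6 * (T * T) * (τ * τ)      ≡⟨ solve 2 (λ T τ → con (ι 6) :* (T :* T) :* (τ :* τ) := con (ι 6) :* (T :* τ :* (T :* τ))) refl T τ ⟩
  ι 6 * (T * τ * (T * τ))      ≡⟨ cong (λ a → ι 6 * (a * a)) Tτ ⟩
  ι 6 * (1ℚ * 1ℚ)              ≡⟨⟩
  ι 6                          ∎
  where open ≡-Reasoning

ι-pellˡ : ∀ t d → ι (4 ℕ.* (d ℕ.* d) ℕ.+ 8 ℕ.* (d ℕ.* t)) ≡ ι 4 * (ι d * ι d) + ι 8 * (ι d * ι t)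
ι-pellˡ t d = trans (ι-+ (4 ℕ.* (d ℕ.* d)) (8 ℕ.* (d ℕ.* t))) (cong₂ _+_
  (trans (ι-* 4 (d ℕ.* d)) (cong (ι 4 *_) (ι-* d d)))
  (trans (ι-* 8 (d ℕ.* t)) (cong (ι 8 *_) (ι-* d t))))

ι-pellʳ : ∀ t → ι (6 ℕ.* (t ℕ.* t)) ≡ ι 6 * (ι t * ι t)
ι-pellʳ t = trans (ι-* 6 (t ℕ.* t)) (cong (ι 6 *_) (ι-* t t))

pell-ℚ : ∀ m {τ} → ι (T m) * τ ≡ 1ℚ → let δ = ι (D m) * τ in
         (ι 4 * (δ * δ) + ι 8 * δ ≡ ι 6 + ι 4 * (τ * τ)) ⊎ (ι 4 * (δ * δ) + ι 8 * δ + ι 4 * (τ * τ) ≡ ι 6)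
pell-ℚ m {τ} Tτ = cases (pell-T m)
  where
  open ≡-Reasoning
  t = T m
  d = D m
  δ = ι d * τ
  left : ι (4 ℕ.* (d ℕ.* d) ℕ.+ 8 ℕ.* (d ℕ.* t)) * (τ * τ) ≡ ι 4 * (δ * δ) + ι 8 * δ
  left = trans (cong (_* (τ * τ)) (ι-pellˡ t d)) (divide-pellˡ {ι t} {ι d} {τ} Tτ)
  right : ι (6 ℕ.* (t ℕ.* t)) * (τ * τ) ≡ ι 6
  right = trans (cong (_* (τ * τ)) (ι-pellʳ t)) (divide-pellʳ {ι t} {τ} Tτ)
  ι-+4 : ∀ k → ι (k ℕ.+ 4) * (τ * τ) ≡ ι k * (τ * τ) + ι 4 * (τ * τ)
  ι-+4 k = trans (cong (_* (τ * τ)) (ι-+ k 4)) (ℚₚ.*-distribʳ-+ (τ * τ) (ι k) (ι 4))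
  cases : (4 ℕ.* (d ℕ.* d) ℕ.+ 8 ℕ.* (d ℕ.* t) ≡ 6 ℕ.* (t ℕ.* t) ℕ.+ 4) ⊎
          (4 ℕ.* (d ℕ.* d) ℕ.+ 8 ℕ.* (d ℕ.* t) ℕ.+ 4 ≡ 6 ℕ.* (t ℕ.* t)) →
          (ι 4 * (δ * δ) + ι 8 * δ ≡ ι 6 + ι 4 * (τ * τ)) ⊎ (ι 4 * (δ * δ) + ι 8 * δ + ι 4 * (τ * τ) ≡ ι 6)
  cases (inj₁ e) = inj₁ (trans (sym left) (trans (cong (λ k → ι k * (τ * τ)) e)
    (trans (ι-+4 (6 ℕ.* (t ℕ.* t))) (cong (_+ ι 4 * (τ * τ)) right))))
  cases (inj₂ e) = inj₂ (trans (cong (_+ ι 4 * (τ * τ)) (sym left)) (trans (sym (ι-+4 (4 ℕ.* (d ℕ.* d) ℕ.+ 8 ℕ.* (d ℕ.* t))))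
    (trans (cong (λ k → ι k * (τ * τ)) e) right)))

En/n-bracket : ∀ m {ε} → ι 10 * ratio 1 (suc m) ℚ.≤ ε →
               ((+ 2 / 5) √< ((+ 3 / 2 + ε) - En/n (suc m))) × (((+ 3 / 2 - ε) - En/n (suc m)) <√ (+ 2 / 5))
En/n-bracket m {ε} ε≥ = bracket {ε} {η} {δ} {τ * τ} {En/n n} (ratio-pos n) ε≥ δ≥ δ≤ 0≤τ² τ²≤η
  (divide-pieces {En/n n} {ι (PS m ℕ.+ PD m)} {ι n} {ι (T m)} {ι (D m)} {η} {τ} Nη Tτ (En/n-* m) (ι-pieces m))
  (pell-ℚ m {τ} Tτ)
  where
  n = suc m
  instance _ = T-nonZero m
  η = ratio 1 n
  τ = ratio 1 (T m)
  δ = ι (D m) * τ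
  0≤η = ℚₚ.<⇒≤ (ratio-pos n)
  0≤τ = ℚₚ.<⇒≤ (ratio-pos (T m))
  Nη : ι n * η ≡ 1ℚ
  Nη = trans (ℚₚ.*-comm (ι n) η) (ratio-* 1 n)
  Tτ : ι (T m) * τ ≡ 1ℚ
  Tτ = trans (ℚₚ.*-comm (ι (T m)) τ) (ratio-* 1 (T m))
  open ℚₚ.≤-Reasoning
  δ≥ : + 1 / 2 ℚ.≤ δ
  δ≥ = begin
    + 1 / 2                        ≡⟨ cong (λ a → (+ 1 / 2) * a) Tτ ⟨
    (+ 1 / 2) * (ι (T m) * τ)      ≤⟨ *-mono-≤ˡ {+ 1 / 2} (ℚₚ.<⇒≤ (ℚₚ.positive⁻¹ (+ 1 / 2))) (*-mono-≤ʳ 0≤τ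
                                        (ι-mono-≤ (ℕₚ.+-monoˡ-≤ (D m) (S≤D m)))) ⟩
    (+ 1 / 2) * (ι (D m ℕ.+ D m) * τ) ≡⟨ cong (λ a → (+ 1 / 2) * (a * τ)) (ι-+ (D m) (D m)) ⟩
    (+ 1 / 2) * ((ι (D m) + ι (D m)) * τ) ≡⟨ solve 2 (λ d τ → con (+ 1 / 2) :* ((d :+ d) :* τ) := d :* τ) refl (ι (D m)) τ ⟩
    δ                              ∎
  δ≤ : δ ℚ.≤ 1ℚ
  δ≤ = begin
    ι (D m) * τ  ≤⟨ *-mono-≤ʳ 0≤τ (ι-mono-≤ (ℕₚ.m≤n+m (D m) (S m))) ⟩
    ι (T m) * τ  ≡⟨ Tτ ⟩
    1ℚ           ∎
  0≤τ² : 0ℚ ℚ.≤ τ * τ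
  0≤τ² = subst (ℚ._≤ τ * τ) (ℚₚ.*-zeroʳ τ) (*-mono-≤ˡ 0≤τ 0≤τ)
  n≤T² : n ≤ T m ℕ.* T m
  n≤T² = ℕₚ.≤-trans (m<S+D m) (ℕₚ.m≤m*n (T m) (T m))
  τ²≤η : τ * τ ℚ.≤ η
  τ²≤η = begin
    τ * τ                             ≡⟨ ℚₚ.*-identityʳ (τ * τ) ⟨
    τ * τ * 1ℚ                        ≡⟨ cong (λ a → τ * τ * a) Nη ⟨
    τ * τ * (ι n * η)                 ≤⟨ *-mono-≤ˡ 0≤τ² (*-mono-≤ʳ 0≤η (ι-mono-≤ n≤T²)) ⟩
    τ * τ * (ι (T m ℕ.* T m) * η)     ≡⟨ cong (λ a → τ * τ * (a * η)) (ι-* (T m) (T m)) ⟩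
    τ * τ * (ι (T m) * ι (T m) * η)   ≡⟨ solve 3 (λ t τ η → τ :* τ :* (t :* t :* η) := t :* τ :* (t :* τ) :* η) refl (ι (T m)) τ η ⟩
    ι (T m) * τ * (ι (T m) * τ) * η   ≡⟨ cong (λ a → a * a * η) Tτ ⟩
    1ℚ * 1ℚ * η                       ≡⟨ ℚₚ.*-identityˡ η ⟩
    η                                 ∎

-- The witness is the denominator of ε: the numerator is at least 1, so 10/n ≤ 1/d ≤ ε.
archimedean : ∀ ε → 0ℚ < ε → ∃[ d ] (ℕ.NonZero d × (∀ n .{{_ : ℕ.NonZero n}} → 10 ℕ.* d ≤ n → ι 10 * ratio 1 n ℚ.≤ ε))
archimedean ε@(mkℚ (+ zero) _ _) (ℚ.*<* (ℤ.+<+ ()))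
archimedean ε@(mkℚ ℤ.+[1+ p ] d-1 _) _ = d , _ , bound
  where
  d = suc d-1
  ε-* : ε * ι d ≡ ι (suc p)
  ε-* = trans (cong (_* ι d) (sym (ℚₚ.↥p/↧p≡p ε))) (ratio-* (suc p) d)
  bound : ∀ n .{{_ : ℕ.NonZero n}} → 10 ℕ.* d ≤ n → ι 10 * ratio 1 n ℚ.≤ ε
  bound n le = ℚₚ.*-cancelʳ-≤-pos (ι d) (begin
    ι 10 * η * ι d          ≡⟨ solve 3 (λ a b c → a :* b :* c := a :* c :* b) refl (ι 10) η (ι d) ⟩
    ι 10 * ι d * η          ≡⟨ cong (_* η) (ι-* 10 d) ⟨
    ι (10 ℕ.* d) * η        ≤⟨ *-mono-≤ʳ (ℚₚ.<⇒≤ (ratio-pos n)) (ι-mono-≤ le) ⟩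
    ι n * η                 ≡⟨ trans (ℚₚ.*-comm (ι n) η) (ratio-* 1 n) ⟩
    ι 1                     ≤⟨ ι-mono-≤ (s≤s z≤n) ⟩
    ι (suc p)               ≡⟨ ε-* ⟨
    ε * ι d                 ∎)
    where
    open ℚₚ.≤-Reasoning
    η = ratio 1 n

theorem5 : (ε : ℚ) → 0ℚ < ε → ∃[ N ] ((n : ℕ) → N ≤ n →
    ((+ 2 / 5) √< ((+ 3 / 2 + ε) - En/n n))
    × (((+ 3 / 2 - ε) - En/n n) <√ (+ 2 / 5)))
theorem5 ε 0<ε with archimedean ε 0<ε
-- The threshold is positive, which rules out n = 0, where `En/n` has only its default value.
... | suc d , _ , bound = 10 ℕ.* suc d , λ where
  (suc m) le → En/n-bracket m (bound (suc m) le)
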